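{- Let $G$ be a connected nontrivial graph and $H$ a graph of order at least three. The following statements hold. (i) If $\Delta(H)=|V(H)|-1$, then $\gamma_R^p(G\circ H)=\gamma_R(G\circ H)$ if and only if $\gamma(H)=1$ and $G$ is an efficient closed domination graph. (ii) If $\Delta(H)=|V(H)|-2$, then $\gamma_R^p(G\circ H)=\gamma_R(G\circ H)$ if and only if there exists a $\zeta(G)$-couple $(A,B)$ such that $A\cup B\in\wp_o(G)$ and $A=\varnothing$ whenever $\delta(H)\ge 1$. (iii) If $\Delta(H)=|V(H)|-3$, then $\gamma_R^p(G\circ H)=\gamma_R(G\circ H)$ if and only if either $\delta(H)=0$ and $\zeta'(G)=2\gamma_t(G)$, or $\delta(H)\ge 1$ and $\gamma_t(G)=2\gamma^p(G)=2\rho(G)$. (iv) If $\Delta(H)\le |V(H)|-4$, then $\gamma_R^p(G\circ H)=\gamma_R(G\circ H)$ if and only if $\delta(H)=0$ and $G$ is an efficient open domination graph.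
   Context: All graphs are finite, simple and undirected; a graph is nontrivial if it has at least two vertices. $\delta(H)$ and $\Delta(H)$ are the minimum and maximum degrees of $H$. $N(v)$ is the open neighbourhood and $N[v]=N(v)\cup\{v\}$. $\mathcal{D}(G)$ is the set of dominating sets of $G$ (sets $S$ such that every vertex outside $S$ has at least one neighbour in $S$) and $\gamma(G)$ is the minimum size of one. $\gamma^p(G)$ is the minimum size of a perfect dominating set (every vertex outside $S$ has exactly one neighbour in $S$). For $G$ without isolated vertices, $\gamma_t(G)$ is the minimum size of a total dominating set (every vertex of $G$ has at least one neighbour in $S$). $\rho(G)$ is the maximum size of a packing, i.e. a set $S$ with $N[u]\cap N[v]=\varnothing$ for all distinct $u,v\in S$. $\wp_o(G)$ is the set of open packings of $G$, i.e. sets $S\subseteq V(G)$ with $N(u)\cap N(v)=\varnothing$ for all distinct $u,v\in S$. For $S\in\wp_o(G)$, $S_0$ is the set of isolated vertices of the induced subgraph $G[S]$ and $S_1=S\setminus S_0$. Define $$\zeta'(G)=\min_{S\in\wp_o(G)\cap\mathcal{D}(G)}\{4|S_0|+2|S_1|\},$$ with $\zeta'(G)=\infty$ if $\wp_o(G)\cap\mathcal{D}(G)=\varnothing$. An ordered couple $(A,B)$ of disjoint sets $A,B\subseteq V(G)$ is a dominating couple of $G$ if every vertex $x\in V(G)\setminus B$ satisfies $N(x)\cap(A\cup B)\ne\varnothing$. $\zeta(G)=\min\{2|A|+3|B|:(A,B)\text{ is a dominating couple of }G\}$, and a $\zeta(G)$-couple is a dominating couple $(A,B)$ with $2|A|+3|B|=\zeta(G)$.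 $G$ is an efficient open domination graph if there is a set $D\subseteq V(G)$ with $V(G)=\bigcup_{u\in D}N(u)$ and $N(u)\cap N(v)=\varnothing$ for all distinct $u,v\in D$. $G$ is an efficient closed domination graph if some dominating set of $G$ is a packing. A Roman dominating function (RDF) on a graph $\Gamma$ is a function $f:V(\Gamma)\to\{0,1,2\}$ such that every vertex $u$ with $f(u)=0$ is adjacent to at least one vertex $v$ with $f(v)=2$; it is a perfect Roman dominating function (PRDF) if every such $u$ is adjacent to exactly one vertex $v$ with $f(v)=2$. The weight is $\sum_v f(v)$; $\gamma_R(\Gamma)$ and $\gamma_R^p(\Gamma)$ are the minimum weights of an RDF and of a PRDF on $\Gamma$, respectively. The lexicographic product $G\circ H$ has vertex set $V(G)\times V(H)$, with $(u,v)$ adjacent to $(x,y)$ iff $ux\in E(G)$, or $u=x$ and $vy\in E(H)$. -}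

module Defs where

open import Data.Fin.Base as Fin using (Fin; toℕ; remQuot)
open import Data.Fin.Patterns using (0F; 2F)
import Data.Fin.Properties as Fin
open import Data.Fin.Subset
  using (Subset; inside; outside; _∈_; _∉_; _∩_; _∪_; _─_; ⁅_⁆; ∣_∣; Nonempty; Empty)
open import Data.Fin.Subset.Properties using (_∈?_; nonempty?)
open import Data.List.Base as List
  using (List; []; _∷_; map; filter; allFin; cartesianProduct; cartesianProductWith)
import Data.List.Extrema
import Data.List.Extrema.Nat as ℕ-Extrema
import Data.Maybe.Base as Maybe
open import Data.Nat.Base using (ℕ; zero; suc; _+_; _*_; _≤_)
import Data.Nat.Properties as ℕ
open import Data.Product.Base using (∃; _×_; _,_)
open import Data.Sum.Base using (_⊎_; inj₁; inj₂)
open import Data.Vec.Base as Vec using (Vec; []; _∷_; lookup; tabulate)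
open import Function.Base using (_∘_)
open import Level using (0ℓ)
open import Relation.Binary.Bundles using (TotalOrder)
open import Relation.Binary.Construct.Closure.ReflexiveTransitive using (Star)
import Relation.Binary.Construct.Add.Supremum.NonStrict as AddSupremum
open import Relation.Binary.Core using (Rel)
open import Relation.Binary.Definitions as Binary using (Symmetric; Irreflexive)
open import Relation.Binary.PropositionalEquality.Core using (_≡_; _≢_; refl; sym)
open import Relation.Nullary.Construct.Add.Supremum using (_⁺; ⊤⁺; [_])
open import Relation.Nullary.Decidable using (does; ¬?; _×-dec_; _⊎-dec_; _→-dec_)
open import Relation.Unary using (Pred; Decidable)

private
  variable
    n m : ℕ

-- ℕ ∪ {∞}; a minimum over an empty collection is ∞.

ℕ∞ : Set
ℕ∞ = ℕ ⁺

open AddSupremum _≤_ public using () renaming (_≤⁺_ to _≤∞_)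

≤∞-totalOrder : TotalOrder 0ℓ 0ℓ 0ℓ
≤∞-totalOrder = record
  { isTotalOrder = AddSupremum.≤⁺-isTotalOrder-≡ _≤_ ℕ.≤-isTotalOrder }

module ∞-Extrema = Data.List.Extrema ≤∞-totalOrder

infixr 7 _·_

_·_ : ℕ → ℕ∞ → ℕ∞
k · x = Maybe.map (k *_) x

minimum : {A : Set} {P : Pred A 0ℓ} → Decidable P → (A → ℕ) → List A → ℕ∞
minimum P? w xs = ∞-Extrema.min ⊤⁺ (map ([_] ∘ w) (filter P? xs))

-- 0 for an empty collection, which never arises for packings: ∅ is one.

maximum : {A : Set} {P : Pred A 0ℓ} → Decidable P → (A → ℕ) → List A → ℕ
maximum P? w xs = ℕ-Extrema.max 0 (map w (filter P? xs))

vectors : {A : Set} → List A → ∀ n → List (Vec A n)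
vectors xs zero    = [] ∷ []
vectors xs (suc n) = cartesianProductWith _∷_ xs (vectors xs n)

subsets : ∀ n → List (Subset n)
subsets = vectors (inside ∷ outside ∷ [])

⟦_⟧ : {P : Pred (Fin n) 0ℓ} → Decidable P → Subset n
⟦ P? ⟧ = tabulate (does ∘ P?)

-- A function V → {0,1,2} is given by its table, with V = Fin n.

Labelling : ℕ → Set
Labelling n = Vec (Fin 3) n

level : Fin 3 → Labelling n → Subset n
level i f = ⟦ (λ v → lookup f v Fin.≟ i) ⟧

weight : Labelling n → ℕ
weight f = Vec.sum (Vec.map toℕ f)

coupleWeight : Subset n × Subset n → ℕ
coupleWeight (A , B) = 2 * ∣ A ∣ + 3 * ∣ B ∣

-- Finite simple graphs of order n, with vertex set Fin n.

record Graph (n : ℕ) : Set₁ where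
  field
    Adj        : Rel (Fin n) 0ℓ
    adj?       : Binary.Decidable Adj
    adj-sym    : Symmetric Adj
    adj-irrefl : Irreflexive _≡_ Adj

module _ (G : Graph n) where

  open Graph G

  Connected : Set
  Connected = ∀ u v → Star Adj u v

  N : Fin n → Subset n
  N v = ⟦ adj? v ⟧

  N[_] : Fin n → Subset n
  N[ v ] = N v ∪ ⁅ v ⁆

  degree : Fin n → ℕ
  degree v = ∣ N v ∣

  Δ : ℕ
  Δ = ℕ-Extrema.max 0 (map degree (allFin n))

  -- A number, not ∞, as soon as the graph has a vertex.

  δ : ℕ∞
  δ = ∞-Extrema.min ⊤⁺ (map ([_] ∘ degree) (allFin n))

  Dominating : Subset n → Set
  Dominating S = ∀ v → v ∉ S → Nonempty (N v ∩ S)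

  PerfectDominating : Subset n → Set
  PerfectDominating S = ∀ v → v ∉ S → ∣ N v ∩ S ∣ ≡ 1

  TotalDominating : Subset n → Set
  TotalDominating S = ∀ v → Nonempty (N v ∩ S)

  Packing : Subset n → Set
  Packing S = ∀ u v → u ∈ S → v ∈ S → u ≢ v → Empty (N[ u ] ∩ N[ v ])

  OpenPacking : Subset n → Set
  OpenPacking S = ∀ u v → u ∈ S → v ∈ S → u ≢ v → Empty (N u ∩ N v)

  EfficientOpenDomination : Set
  EfficientOpenDomination =
    ∃ λ D → (∀ v → ∃ λ u → u ∈ D × v ∈ N u) × OpenPacking D

  EfficientClosedDomination : Set
  EfficientClosedDomination = ∃ λ S → Dominating S × Packing S

  dominating? : Decidable Dominating
  dominating? S = Fin.all? λ v → ¬? (v ∈? S) →-dec nonempty? (N v ∩ S)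

  perfectDominating? : Decidable PerfectDominating
  perfectDominating? S =
    Fin.all? λ v → ¬? (v ∈? S) →-dec (∣ N v ∩ S ∣ ℕ.≟ 1)

  totalDominating? : Decidable TotalDominating
  totalDominating? S = Fin.all? λ v → nonempty? (N v ∩ S)

  packing? : Decidable Packing
  packing? S = Fin.all? λ u → Fin.all? λ v →
    (u ∈? S) →-dec ((v ∈? S) →-dec
      (¬? (u Fin.≟ v) →-dec ¬? (nonempty? (N[ u ] ∩ N[ v ]))))

  openPacking? : Decidable OpenPacking
  openPacking? S = Fin.all? λ u → Fin.all? λ v →
    (u ∈? S) →-dec ((v ∈? S) →-dec
      (¬? (u Fin.≟ v) →-dec ¬? (nonempty? (N u ∩ N v))))

  γ : ℕ∞
  γ = minimum dominating? ∣_∣ (subsets n)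

  γᵖ : ℕ∞
  γᵖ = minimum perfectDominating? ∣_∣ (subsets n)

  -- ∞ exactly when some vertex is isolated.

  γₜ : ℕ∞
  γₜ = minimum totalDominating? ∣_∣ (subsets n)

  ρ : ℕ
  ρ = maximum packing? ∣_∣ (subsets n)

  -- S₀ and S₁: the isolated vertices of the subgraph induced by S, and the
  -- other vertices of S.

  isolated nonIsolated : Subset n → Subset n
  isolated S    = ⟦ (λ v → (v ∈? S) ×-dec ¬? (nonempty? (N v ∩ S))) ⟧
  nonIsolated S = S ─ isolated S

  ζ′ : ℕ∞
  ζ′ = minimum (λ S → openPacking? S ×-dec dominating? S)
               (λ S → 4 * ∣ isolated S ∣ + 2 * ∣ nonIsolated S ∣)
               (subsets n)

  DominatingCouple : Subset n × Subset n → Set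
  DominatingCouple (A , B) =
    Empty (A ∩ B) × (∀ x → x ∉ B → Nonempty (N x ∩ (A ∪ B)))

  dominatingCouple? : Decidable DominatingCouple
  dominatingCouple? (A , B) =
    ¬? (nonempty? (A ∩ B)) ×-dec
    Fin.all? λ x → ¬? (x ∈? B) →-dec nonempty? (N x ∩ (A ∪ B))

  ζ : ℕ∞
  ζ = minimum dominatingCouple? coupleWeight
              (cartesianProduct (subsets n) (subsets n))

  ζ-Couple : Subset n × Subset n → Set
  ζ-Couple c = DominatingCouple c × [ coupleWeight c ] ≡ ζ

  IsRDF : Labelling n → Set
  IsRDF f = ∀ u → lookup f u ≡ 0F → Nonempty (N u ∩ level 2F f)

  IsPRDF : Labelling n → Set
  IsPRDF f = ∀ u → lookup f u ≡ 0F → ∣ N u ∩ level 2F f ∣ ≡ 1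

  isRDF? : Decidable IsRDF
  isRDF? f = Fin.all? λ u →
    (lookup f u Fin.≟ 0F) →-dec nonempty? (N u ∩ level 2F f)

  isPRDF? : Decidable IsPRDF
  isPRDF? f = Fin.all? λ u →
    (lookup f u Fin.≟ 0F) →-dec (∣ N u ∩ level 2F f ∣ ℕ.≟ 1)

  γᴿ : ℕ∞
  γᴿ = minimum isRDF? weight (vectors (allFin 3) n)

  γᴿᵖ : ℕ∞
  γᴿᵖ = minimum isPRDF? weight (vectors (allFin 3) n)

-- The vertex set Fin n × Fin m is numbered by Fin (n * m) via remQuot.

module _ (G : Graph n) (H : Graph m) where

  private
    module G = Graph G
    module H = Graph H

  LexAdj : Rel (Fin n × Fin m) 0ℓ
  LexAdj (u , v) (x , y) = G.Adj u x ⊎ (u ≡ x × H.Adj v y)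

  lexAdj? : Binary.Decidable LexAdj
  lexAdj? (u , v) (x , y) =
    G.adj? u x ⊎-dec ((u Fin.≟ x) ×-dec H.adj? v y)

  lexAdj-sym : Symmetric LexAdj
  lexAdj-sym (inj₁ ux)       = inj₁ (G.adj-sym ux)
  lexAdj-sym (inj₂ (eq , vy)) = inj₂ (sym eq , H.adj-sym vy)

  lexAdj-irrefl : Irreflexive _≡_ LexAdj
  lexAdj-irrefl refl (inj₁ uu)       = G.adj-irrefl refl uu
  lexAdj-irrefl refl (inj₂ (_ , vv)) = H.adj-irrefl refl vv

infixr 9 _∘ᴳ_

_∘ᴳ_ : Graph n → Graph m → Graph (n * m)
_∘ᴳ_ {m = m} G H = record
  { Adj        = λ p q → LexAdj G H (remQuot m p) (remQuot m q)
  ; adj?       = λ p q → lexAdj? G H (remQuot m p) (remQuot m q)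
  ; adj-sym    = lexAdj-sym G H
  ; adj-irrefl = λ { refl → lexAdj-irrefl G H refl }
  }

{-# OPTIONS --safe #-}

-- From a Roman dominating labelling of G ∘ H read off the set S of vertices of G whose copy
-- of H carries a 2, and the set B of those with no neighbour in S.  Let Δ H + 1 + k = m with
-- k ≤ 2.  A copy over B weighs at least 2 + k and any other copy over S at least 2, so that
-- γᴿ (G ∘ H) is the least value of 2|S| + k|B| over the pairs B ⊆ S such that every vertex
-- outside B has a neighbour in S.  A perfect labelling of this weight attains every local
-- bound; perfection then makes the neighbour in S unique, and forces S = B unless H has an
-- isolated vertex, since the 2 of a copy over S ∖ B has to sit on one.  For k = 0, 1, 2 the
-- cheapest pairs amount to minimum dominating sets, ζ-couples, and (trading each vertex of
-- B for a neighbour) minimum total dominating sets of G.  If Δ H + 4 ≤ m, the bounds for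
-- k = 2 still hold, but a perfect labelling attaining them has B = ∅.

module Submission where

open import Data.Bool.Base using (true; false; if_then_else_)
open import Data.Fin.Base as Fin using (Fin; zero; suc; toℕ; remQuot; combine; _↑ˡ_; _↑ʳ_)
open import Data.Fin.Patterns using (0F; 1F; 2F)
open import Data.Fin.Properties as Fin using (any?; remQuot-combine; combine-remQuot)
open import Data.Fin.Subset
open import Data.Fin.Subset.Properties
open import Data.List.Base as List using (List; []; _∷_; map; filter; allFin)
import Data.List.Extrema.Nat as ℕ-Extrema
open import Data.List.Membership.Propositional renaming (_∈_ to _∈ᴸ_) using ()
open import Data.List.Membership.Propositional.Properties
  using (∈-map⁺; ∈-map⁻; ∈-filter⁺; ∈-filter⁻; ∈-cartesianProduct⁺; ∈-cartesianProductWith⁺; ∈-allFin)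
open import Data.List.Relation.Unary.All as All using (All)
open import Data.List.Relation.Unary.Any using (here; there)
open import Data.Maybe.Base using (just)
open import Data.Maybe.Properties using (just-injective)
open import Data.Nat.Base using (ℕ; zero; suc; _+_; _*_; _∸_; _≤_; _<_; z≤n; s≤s)
open import Data.Nat.Properties
open import Data.Nat.Tactic.RingSolver using (solve-∀)
open import Data.Product using (∃; ∃₂; ∃!; _×_; _,_; proj₁; proj₂; uncurry)
open import Data.Sum.Base using (_⊎_; inj₁; inj₂; [_,_]′)
open import Data.Vec.Base as Vec using (Vec; []; _∷_; lookup; tabulate; here; there)
open import Data.Vec.Properties using (lookup∘tabulate; []=⇒lookup; lookup⇒[]=)
open import Function.Base using (_∘_; id)
open import Function.Bundles using (_⇔_; mk⇔; Equivalence)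
open import Level using (0ℓ)
open import Relation.Binary.PropositionalEquality
open import Relation.Binary.Construct.Closure.ReflexiveTransitive using (ε; _◅_)
open import Relation.Nullary.Construct.Add.Supremum using (⊤⁺; [_])
open import Relation.Nullary using (¬_; Dec; yes; no; does; contradiction)
open import Relation.Nullary.Decidable using (¬?; _×-dec_; dec-true; dec-false; decidable-stable)
open import Relation.Unary using (Pred; Decidable)
open import Relation.Binary.Construct.Add.Supremum.NonStrict _≤_ using () renaming ([_] to [_]≤)
open import Defs

open import Algebra.Properties.Semiring.Sum +-*-semiring
  using (sum; ∑-distrib-+; *-distribˡ-sum; ∑-comm; sum-cong-≗)

private
  variable
    n m k : ℕ
    A : Set
    P : Set

-- Minima

IsMinimum : Pred A 0ℓ → (A → ℕ) → ℕ → Set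
IsMinimum P w k = (∃ λ x → P x × w x ≡ k) × (∀ y → P y → k ≤ w y)

IsMinimum-unique : {P : Pred A 0ℓ} {w : A → ℕ} {k l : ℕ} →
                   IsMinimum P w k → IsMinimum P w l → k ≡ l
IsMinimum-unique ((x , Px , refl) , k≤) ((y , Py , refl) , l≤) =
  ≤-antisym (k≤ y Py) (l≤ x Px)

min-map⁻ : (w : A → ℕ) (xs : List A) →
           ∞-Extrema.min ⊤⁺ (map ([_] ∘ w) xs) ≡ [ k ] → IsMinimum (_∈ᴸ xs) w k
min-map⁻ w xs eq with ∞-Extrema.argmin-sel id ⊤⁺ (map ([_] ∘ w) xs)
... | inj₁ eq′ = contradiction (trans (sym eq) eq′) λ ()
... | inj₂ m∈ with ∈-map⁻ ([_] ∘ w) m∈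
...   | x , x∈ , eq′ =
  (x , x∈ , just-injective (trans (sym eq′) eq)) ,
  λ y y∈ → lower (All.lookup (∞-Extrema.min≤xs ⊤⁺ (map ([_] ∘ w) xs)) (∈-map⁺ ([_] ∘ w) y∈)) eq
  where
  lower : ∀ {i l k} → i ≤∞ [ l ] → i ≡ [ k ] → k ≤ l
  lower [ p ]≤ refl = p

min-map-finite : (w : A → ℕ) (xs : List A) {x : A} → x ∈ᴸ xs →
                 ∃ λ k → ∞-Extrema.min ⊤⁺ (map ([_] ∘ w) xs) ≡ [ k ]
min-map-finite w xs x∈ =
  finite (All.lookup (∞-Extrema.min≤xs ⊤⁺ (map ([_] ∘ w) xs)) (∈-map⁺ ([_] ∘ w) x∈))
  where
  finite : ∀ {i l} → i ≤∞ [ l ] → ∃ λ k → i ≡ [ k ]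
  finite [ _ ]≤ = _ , refl

module _ {P : Pred A 0ℓ} (P? : Decidable P) (w : A → ℕ) {xs : List A} (all : ∀ x → x ∈ᴸ xs) where

  minimum⁻ : minimum P? w xs ≡ [ k ] → IsMinimum P w k
  minimum⁻ eq with min-map⁻ w (filter P? xs) eq
  ... | (x , x∈ , wx) , k≤ =
    (x , proj₂ (∈-filter⁻ P? {xs = xs} x∈) , wx) , λ y Py → k≤ y (∈-filter⁺ P? (all y) Py)

  minimum-finite : ∃ P → ∃ λ k → minimum P? w xs ≡ [ k ]
  minimum-finite (x , Px) = min-map-finite w (filter P? xs) (∈-filter⁺ P? (all x) Px)

  minimum⁺ : IsMinimum P w k → minimum P? w xs ≡ [ k ]
  minimum⁺ min@((x , Px , _) , _) with minimum-finite (x , Px)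
  ... | l , eq = trans eq (cong [_] (IsMinimum-unique (minimum⁻ eq) min))

  maximum⁺ : (∃ λ x → P x × w x ≡ k) → (∀ y → P y → w y ≤ k) → maximum P? w xs ≡ k
  maximum⁺ (x , Px , refl) w≤ = ≤-antisym
    (ℕ-Extrema.max≤v⁺ z≤n (All.tabulate λ z∈ → bound (∈-map⁻ w z∈)))
    (All.lookup (ℕ-Extrema.xs≤max 0 _) (∈-map⁺ w (∈-filter⁺ P? (all x) Px)))
    where
    bound : ∀ {z} → (∃ λ y → y ∈ᴸ filter P? xs × z ≡ w y) → z ≤ w x
    bound (y , y∈ , refl) = w≤ y (proj₂ (∈-filter⁻ P? {xs = xs} y∈))

∈-vectors : {xs : List A} → (∀ x → x ∈ᴸ xs) → ∀ n (v : Vec A n) → v ∈ᴸ vectors xs n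
∈-vectors all zero    []      = here refl
∈-vectors all (suc n) (x ∷ v) = ∈-cartesianProductWith⁺ _∷_ (all x) (∈-vectors all n v)

∈-subsets : (S : Subset n) → S ∈ᴸ subsets n
∈-subsets = ∈-vectors (λ { true → here refl ; false → there (here refl) }) _

-- Finite sums and cardinalities

sum-mono : {f g : Fin n → ℕ} → (∀ i → f i ≤ g i) → sum f ≤ sum g
sum-mono {zero}  f≤g = z≤n
sum-mono {suc n} f≤g = +-mono-≤ (f≤g 0F) (sum-mono (f≤g ∘ suc))

-- Termwise inequalities leave no slack once the sums compare the other way: cancelling the tails
-- settles the head, cancelling the heads passes to the tails.
sum-mono-rigid : {f g : Fin n → ℕ} → (∀ i → f i ≤ g i) → sum g ≤ sum f → ∀ i → f i ≡ g i
sum-mono-rigid {suc n} {f} {g} f≤g g≤f zero = ≤-antisym (f≤g 0F)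
  (+-cancelʳ-≤ (sum (g ∘ suc)) _ _ (≤-trans g≤f (+-monoʳ-≤ (f 0F) (sum-mono (f≤g ∘ suc)))))
sum-mono-rigid {suc n} {f} {g} f≤g g≤f (suc i) = sum-mono-rigid (f≤g ∘ suc)
  (+-cancelˡ-≤ (g 0F) _ _ (≤-trans g≤f (+-monoˡ-≤ (sum (f ∘ suc)) (f≤g 0F)))) i

term≤sum : (f : Fin n → ℕ) (i : Fin n) → f i ≤ sum f
term≤sum f zero    = m≤m+n (f 0F) _
term≤sum f (suc i) = ≤-trans (term≤sum (f ∘ suc) i) (m≤n+m _ (f 0F))

pair≤sum : (f : Fin n → ℕ) {i j : Fin n} → i ≢ j → f i + f j ≤ sum f
pair≤sum f {zero}  {zero}  i≢j = contradiction refl i≢j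
pair≤sum f {zero}  {suc j} i≢j = +-monoʳ-≤ (f 0F) (term≤sum (f ∘ suc) j)
pair≤sum f {suc i} {zero}  i≢j = subst (_≤ sum f) (+-comm (f 0F) _)
  (+-monoʳ-≤ (f 0F) (term≤sum (f ∘ suc) i))
pair≤sum f {suc i} {suc j} i≢j =
  ≤-trans (pair≤sum (f ∘ suc) (i≢j ∘ cong suc)) (m≤n+m _ (f 0F))

sum-zero : {f : Fin n → ℕ} → (∀ i → f i ≡ 0) → sum f ≡ 0
sum-zero {zero}  f≡0 = refl
sum-zero {suc n} f≡0 = cong₂ _+_ (f≡0 0F) (sum-zero (f≡0 ∘ suc))

sum-one : ∀ n → sum {n} (λ _ → 1) ≡ n
sum-one zero    = refl
sum-one (suc n) = cong suc (sum-one n)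

sum-atMostOne : (f : Fin n → ℕ) → (∀ i → f i ≤ 1) →
                (∀ i j → f i ≢ 0 → f j ≢ 0 → i ≡ j) → sum f ≤ 1
sum-atMostOne {zero}  f f≤1 uniq = z≤n
sum-atMostOne {suc n} f f≤1 uniq with f 0F in eq
... | zero = sum-atMostOne (f ∘ suc) (f≤1 ∘ suc) λ i j fi fj → Fin.suc-injective (uniq (suc i) (suc j) fi fj)
... | suc l = subst (λ s → suc l + s ≤ 1) (sym (sum-zero tail≡0))
        (subst (_≤ 1) (trans eq (sym (+-identityʳ (suc l)))) (f≤1 0F))
  where
  tail≡0 : ∀ i → f (suc i) ≡ 0
  tail≡0 i with f (suc i) in eq′
  ... | zero  = refl
  ... | suc _ with uniq 0F (suc i) (λ z → contradiction (trans (sym eq) z) λ ())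
                                   (λ z → contradiction (trans (sym eq′) z) λ ())
  ...   | ()

sum-++ : ∀ a {b} (f : Fin (a + b) → ℕ) → sum f ≡ sum (f ∘ (_↑ˡ b)) + sum (f ∘ (a ↑ʳ_))
sum-++ zero    f = refl
sum-++ (suc a) f = trans (cong (f 0F +_) (sum-++ a (f ∘ suc))) (sym (+-assoc (f 0F) _ _))

sum-combine : ∀ n {m} (f : Fin (n * m) → ℕ) →
              sum f ≡ sum (λ u → sum (λ v → f (combine {n} {m} u v)))
sum-combine zero    f = refl
sum-combine (suc n) {m} f = trans (sum-++ m f) (cong (sum (f ∘ (_↑ˡ n * m)) +_) (sum-combine n (f ∘ (m ↑ʳ_))))

Vec-sum-map : (g : A → ℕ) (v : Vec A n) → Vec.sum (Vec.map g v) ≡ sum (g ∘ lookup v)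
Vec-sum-map g []      = refl
Vec-sum-map g (x ∷ v) = cong (g x +_) (Vec-sum-map g v)

-- The Iverson bracket, which turns cardinalities and weights into sums that can be compared term by
-- term.
ι : Dec P → ℕ
ι P? = if does P? then 1 else 0

ι-yes : (P? : Dec P) → P → ι P? ≡ 1
ι-yes P? p rewrite dec-true P? p = refl

ι-no : (P? : Dec P) → ¬ P → ι P? ≡ 0
ι-no P? ¬p rewrite dec-false P? ¬p = refl

ι≤1 : (P? : Dec P) → ι P? ≤ 1
ι≤1 (yes _) = s≤s z≤n
ι≤1 (no _)  = z≤n

ι≢0 : (P? : Dec P) → ι P? ≢ 0 → P
ι≢0 (yes p) _  = p
ι≢0 (no _)  ≢0 = contradiction refl ≢0

∣∣≡sum : (S : Subset n) → ∣ S ∣ ≡ sum (λ u → ι (u ∈? S))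
∣∣≡sum []            = refl
∣∣≡sum (inside ∷ S)  = cong suc (∣∣≡sum S)
∣∣≡sum (outside ∷ S) = ∣∣≡sum S

∈⟦⟧⁺ : {P : Pred (Fin n) 0ℓ} (P? : Decidable P) {v : Fin n} → P v → v ∈ ⟦ P? ⟧
∈⟦⟧⁺ P? {v} p = lookup⇒[]= v _ (trans (lookup∘tabulate (does ∘ P?) v) (dec-true (P? v) p))

∈⟦⟧⁻ : {P : Pred (Fin n) 0ℓ} (P? : Decidable P) {v : Fin n} → v ∈ ⟦ P? ⟧ → P v
∈⟦⟧⁻ P? {v} v∈ with P? v | trans (sym (lookup∘tabulate (does ∘ P?) v)) ([]=⇒lookup v∈)
... | yes p | _ = p

x∈p─q⇒x∉q : {p q : Subset n} {x : Fin n} → x ∈ p ─ q → x ∉ q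
x∈p─q⇒x∉q {p = _ ∷ _} {q = outside ∷ _} (there x∈) (there x∈q) = x∈p─q⇒x∉q x∈ x∈q
x∈p─q⇒x∉q {p = _ ∷ _} {q = inside ∷ _}  (there x∈) (there x∈q) = x∈p─q⇒x∉q x∈ x∈q

∣p─q∣+∣q∣≡∣p∣ : {p q : Subset n} → q ⊆ p → ∣ p ─ q ∣ + ∣ q ∣ ≡ ∣ p ∣
∣p─q∣+∣q∣≡∣p∣ {p = []}          {[]}          q⊆p = refl
∣p─q∣+∣q∣≡∣p∣ {p = inside ∷ p}  {inside ∷ q}  q⊆p = trans (+-suc _ _) (cong suc (∣p─q∣+∣q∣≡∣p∣ (drop-∷-⊆ q⊆p)))
∣p─q∣+∣q∣≡∣p∣ {p = inside ∷ p}  {outside ∷ q} q⊆p = cong suc (∣p─q∣+∣q∣≡∣p∣ (drop-∷-⊆ q⊆p))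
∣p─q∣+∣q∣≡∣p∣ {p = outside ∷ p} {inside ∷ q}  q⊆p = contradiction (q⊆p here) λ ()
∣p─q∣+∣q∣≡∣p∣ {p = outside ∷ p} {outside ∷ q} q⊆p = ∣p─q∣+∣q∣≡∣p∣ (drop-∷-⊆ q⊆p)

p∪q─q≡p : {p q : Subset n} → Empty (p ∩ q) → p ∪ q ─ q ≡ p
p∪q─q≡p {p = p} {q} disjoint = ⊆-antisym
  (λ x∈ → [ id , (λ x∈q → contradiction x∈q (x∈p─q⇒x∉q x∈)) ]′ (x∈p∪q⁻ p q (p─q⊆p (p ∪ q) q x∈)))
  (λ x∈p → x∈p∧x∉q⇒x∈p─q (x∈p∪q⁺ (inj₁ x∈p)) (λ x∈q → disjoint (_ , x∈p∩q⁺ (x∈p , x∈q))))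

p─q∪q≡p : {p q : Subset n} → q ⊆ p → (p ─ q) ∪ q ≡ p
p─q∪q≡p {p = p} {q} q⊆p = ⊆-antisym
  (λ x∈ → [ p─q⊆p p q , q⊆p ]′ (x∈p∪q⁻ (p ─ q) q x∈)) from
  where
  from : p ⊆ (p ─ q) ∪ q
  from {x} x∈p with x ∈? q
  ... | yes x∈q = x∈p∪q⁺ (inj₂ x∈q)
  ... | no  x∉q = x∈p∪q⁺ (inj₁ (x∈p∧x∉q⇒x∈p─q x∈p x∉q))

∣p∪q∣≤∣p∣+∣q∣ : (p q : Subset n) → ∣ p ∪ q ∣ ≤ ∣ p ∣ + ∣ q ∣
∣p∪q∣≤∣p∣+∣q∣ []            []            = z≤n
∣p∪q∣≤∣p∣+∣q∣ (outside ∷ p) (outside ∷ q) = ∣p∪q∣≤∣p∣+∣q∣ p q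
∣p∪q∣≤∣p∣+∣q∣ (outside ∷ p) (inside ∷ q)  =
  subst (suc ∣ p ∪ q ∣ ≤_) (sym (+-suc _ _)) (s≤s (∣p∪q∣≤∣p∣+∣q∣ p q))
∣p∪q∣≤∣p∣+∣q∣ (inside ∷ p)  (outside ∷ q) = s≤s (∣p∪q∣≤∣p∣+∣q∣ p q)
∣p∪q∣≤∣p∣+∣q∣ (inside ∷ p)  (inside ∷ q)  =
  s≤s (≤-trans (∣p∪q∣≤∣p∣+∣q∣ p q) (+-monoʳ-≤ ∣ p ∣ (n≤1+n _)))

∈⇒0<∣∣ : {p : Subset n} {x : Fin n} → x ∈ p → 0 < ∣ p ∣
∈⇒0<∣∣ {p = p} {x} x∈p = subst (_≤ ∣ p ∣) (∣⁅x⁆∣≡1 x)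
  (p⊆q⇒∣p∣≤∣q∣ λ y∈ → subst (_∈ p) (sym (x∈⁅y⁆⇒x≡y x y∈)) x∈p)

∣∣≡1⇔∃! : {p : Subset n} → ∣ p ∣ ≡ 1 ⇔ ∃! _≡_ (_∈ p)
∣∣≡1⇔∃! {n} {p} = mk⇔ (to p) from
  where
  to : ∀ {n} (p : Subset n) → ∣ p ∣ ≡ 1 → ∃! _≡_ (_∈ p)
  to (outside ∷ p) eq with to p eq
  ... | x , x∈p , uniq = suc x , there x∈p , λ { (there y∈p) → cong suc (uniq y∈p) }
  to (inside ∷ p) eq = zero , here , λ
    { here        → refl
    ; (there y∈p) → contradiction (suc-injective eq) (>⇒≢ (∈⇒0<∣∣ y∈p)) }
  from : ∃! _≡_ (_∈ p) → ∣ p ∣ ≡ 1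
  from (x , x∈p , uniq) = trans (cong ∣_∣ (⊆-antisym
    (λ y∈p → subst (_∈ ⁅ x ⁆) (uniq y∈p) (x∈⁅x⁆ x))
    (λ y∈ → subst (_∈ p) (sym (x∈⁅y⁆⇒x≡y x y∈)) x∈p))) (∣⁅x⁆∣≡1 x)

-- Double counting of the related pairs between `S` and `X`: each row over `S` contains at least
-- one, each column over `X` at most one.
∣∣≤-by-relation : {R : Fin n → Fin n → Set} → (∀ u x → Dec (R u x)) → {S X : Subset n} →
                  (∀ u → u ∈ S → ∃ λ x → x ∈ X × R u x) →
                  (∀ x u v → x ∈ X → u ∈ S → v ∈ S → R u x → R v x → u ≡ v) →
                  ∣ S ∣ ≤ ∣ X ∣
∣∣≤-by-relation {n} {R} R? {S} {X} total injective = begin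
  ∣ S ∣                          ≡⟨ ∣∣≡sum S ⟩
  sum (λ u → ι (u ∈? S))         ≤⟨ sum-mono row ⟩
  sum (λ u → sum (λ x → M u x))  ≡⟨ ∑-comm M ⟩
  sum (λ x → sum (λ u → M u x))  ≤⟨ sum-mono column ⟩
  sum (λ x → ι (x ∈? X))         ≡⟨ ∣∣≡sum X ⟨
  ∣ X ∣                          ∎
  where
  open ≤-Reasoning
  M? : ∀ u x → Dec (u ∈ S × x ∈ X × R u x)
  M? u x = (u ∈? S) ×-dec ((x ∈? X) ×-dec R? u x)
  M : Fin n → Fin n → ℕ
  M u x = ι (M? u x)
  row : ∀ u → ι (u ∈? S) ≤ sum (λ x → M u x)
  row u with u ∈? S in eq
  ... | no  _   = z≤n
  ... | yes u∈S with total u u∈S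
  ...   | x , x∈X , ux = ≤-trans (≤-reflexive (sym (ι-yes (yes u∈S ×-dec ((x ∈? X) ×-dec R? u x)) (u∈S , x∈X , ux))))
                       (term≤sum (λ x → ι (yes u∈S ×-dec ((x ∈? X) ×-dec R? u x))) x)
  column : ∀ x → sum (λ u → M u x) ≤ ι (x ∈? X)
  column x with x ∈? X
  ... | yes x∈X = sum-atMostOne _ (λ u → ι≤1 ((u ∈? S) ×-dec (yes x∈X ×-dec R? u x))) λ u v ux vx →
    let (u∈ , _ , ux) = ι≢0 ((u ∈? S) ×-dec (yes x∈X ×-dec R? u x)) ux
        (v∈ , _ , vx) = ι≢0 ((v ∈? S) ×-dec (yes x∈X ×-dec R? v x)) vx
    in injective x u v x∈X u∈ v∈ ux vx
  ... | no  x∉X = ≤-reflexive (sum-zero λ u → ι-no ((u ∈? S) ×-dec (no x∉X ×-dec R? u x)) (x∉X ∘ proj₁ ∘ proj₂))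

preimage? : (φ : Fin n → Fin n) (S : Subset n) → Decidable (λ x → ∃ λ u → u ∈ S × x ≡ φ u)
preimage? φ S x = any? λ u → (u ∈? S) ×-dec (x Fin.≟ φ u)

image : (Fin n → Fin n) → Subset n → Subset n
image φ S = ⟦ preimage? φ S ⟧

∈-image : (φ : Fin n → Fin n) {S : Subset n} {u : Fin n} → u ∈ S → φ u ∈ image φ S
∈-image φ {S} u∈S = ∈⟦⟧⁺ (preimage? φ S) (_ , u∈S , refl)

∣image∣≤ : (φ : Fin n → Fin n) (S : Subset n) → ∣ image φ S ∣ ≤ ∣ S ∣
∣image∣≤ φ S = ∣∣≤-by-relation (λ x u → x Fin.≟ φ u) {image φ S} {S}
  (λ x → ∈⟦⟧⁻ (preimage? φ S))
  λ _ _ _ _ _ _ x≡ y≡ → trans x≡ (sym y≡)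

weighted-sum : ∀ a b (S B : Subset n) →
               sum (λ u → a * ι (u ∈? S) + b * ι (u ∈? B)) ≡ a * ∣ S ∣ + b * ∣ B ∣
weighted-sum a b S B = trans (∑-distrib-+ (λ u → a * ι (u ∈? S)) (λ u → b * ι (u ∈? B)))
  (cong₂ _+_ (scale a S) (scale b B))
  where
  scale : ∀ a (S : Subset _) → sum (λ u → a * ι (u ∈? S)) ≡ a * ∣ S ∣
  scale a S = trans (sym (*-distribˡ-sum a (λ u → ι (u ∈? S)))) (cong (a *_) (sym (∣∣≡sum S)))

-- Neighbourhoods and label classes in terms of adjacency

∈N⁺ : (G : Graph n) {u x : Fin n} → Graph.Adj G u x → x ∈ N G u
∈N⁺ G {u} = ∈⟦⟧⁺ (Graph.adj? G u)

∈N⁻ : (G : Graph n) {u x : Fin n} → x ∈ N G u → Graph.Adj G u x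
∈N⁻ G {u} = ∈⟦⟧⁻ (Graph.adj? G u)

meetsN⁺ : (G : Graph n) {u x : Fin n} {S : Subset n} →
          Graph.Adj G u x → x ∈ S → Nonempty (N G u ∩ S)
meetsN⁺ G ux x∈S = _ , x∈p∩q⁺ (∈N⁺ G ux , x∈S)

meetsN⁻ : (G : Graph n) {u : Fin n} {S : Subset n} →
          Nonempty (N G u ∩ S) → ∃ λ x → Graph.Adj G u x × x ∈ S
meetsN⁻ G {u} {S} (x , x∈) with x∈p∩q⁻ (N G u) S x∈
... | x∈N , x∈S = x , ∈N⁻ G x∈N , x∈S

∣N∩S∣≡1⇔∃! : (G : Graph n) {u : Fin n} {S : Subset n} →
             ∣ N G u ∩ S ∣ ≡ 1 ⇔ ∃! _≡_ (λ x → Graph.Adj G u x × x ∈ S)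
∣N∩S∣≡1⇔∃! G {u} {S} = mk⇔
  (λ eq → let (x , x∈ , uniq) = Equivalence.to ∣∣≡1⇔∃! eq
              (x∈N , x∈S) = x∈p∩q⁻ (N G u) S x∈
          in x , (∈N⁻ G x∈N , x∈S) , λ {_} (uy , y∈S) → uniq (x∈p∩q⁺ (∈N⁺ G uy , y∈S)))
  (λ (x , (ux , x∈S) , uniq) → Equivalence.from ∣∣≡1⇔∃!
     (x , x∈p∩q⁺ (∈N⁺ G ux , x∈S) , λ y∈ →
       let (y∈N , y∈S) = x∈p∩q⁻ (N G u) S y∈ in uniq (∈N⁻ G y∈N , y∈S)))

∈-level⁺ : {f : Labelling n} {i : Fin 3} {v : Fin n} → lookup f v ≡ i → v ∈ level i f
∈-level⁺ {f = f} {i} = ∈⟦⟧⁺ (λ v → lookup f v Fin.≟ i)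

∈-level⁻ : {f : Labelling n} {i : Fin 3} {v : Fin n} → v ∈ level i f → lookup f v ≡ i
∈-level⁻ {f = f} {i} = ∈⟦⟧⁻ (λ v → lookup f v Fin.≟ i)

-- Covers: the trace on `G` of a labelling of the product

module _ (G : Graph n) where

  open Graph G

  -- `S` stands for the copies carrying a 2 and `B` for those that must manage without help from
  -- neighbouring copies; a vertex of `B` may still have a neighbour in `S`.
  Cover : Subset n → Subset n → Set
  Cover S B = B ⊆ S × (∀ u → u ∉ B → ∃ λ x → Adj u x × x ∈ S)

  -- Here a vertex has exactly one neighbour in `S`, or lies in `B` and has none.
  PerfectCover : Subset n → Subset n → Set
  PerfectCover S B = B ⊆ S × (∀ u → u ∉ B → ∃! _≡_ λ x → Adj u x × x ∈ S) ×
                     (∀ u x → u ∈ B → Adj u x → x ∉ S)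

  NoIsolated : Set
  NoIsolated = ∀ u → ∃ λ x → Adj u x

  Isolated : Fin n → Set
  Isolated u = ∀ x → ¬ Adj u x

-- For a cover `B` lies in `S`, so a vertex of `B` is charged 2 + `k` in all.
cost : ℕ → Subset n → Subset n → ℕ
cost k S B = 2 * ∣ S ∣ + k * ∣ B ∣

Cheapest : Graph n → ℕ → Subset n → Subset n → Set
Cheapest G k S B = ∀ S′ B′ → Cover G S′ B′ → cost k S B ≤ cost k S′ B′

perfect⇒cover : (G : Graph n) {S B : Subset n} → PerfectCover G S B → Cover G S B
perfect⇒cover G (B⊆S , uniq , _) = B⊆S , λ u u∉B → let (x , px , _) = uniq u u∉B in x , px

-- Labellings of a single copy of H

wt : (Fin m → Fin 3) → ℕ
wt g = sum (toℕ ∘ g)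

-- Labels that are all positive already weigh `m`.
zero-value : {g : Fin m → Fin 3} → wt g < m → ∃ λ v → g v ≡ 0F
zero-value {m} {g} small with any? (λ v → g v Fin.≟ 0F)
... | yes z = z
... | no ¬z = contradiction small (≤⇒≯ (subst (_≤ wt g) (sum-one m) (sum-mono λ v → positive (g v) (λ z → ¬z (v , z)))))
  where
  positive : (i : Fin 3) → i ≢ 0F → 1 ≤ toℕ i
  positive 0F i≢0 = contradiction refl i≢0
  positive (suc _) _ = s≤s z≤n

spike : Fin m → Fin m → Fin 3
spike c v = if does (v ∈? ⁅ c ⁆) then 2F else 0F

spike-self : (c : Fin m) → spike c c ≡ 2F
spike-self c rewrite dec-true (c ∈? ⁅ c ⁆) (x∈⁅x⁆ c) = refl

spike≡2 : {c v : Fin m} → spike c v ≡ 2F → v ≡ c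
spike≡2 {c = c} {v} eq with v ∈? ⁅ c ⁆
... | yes v∈ = x∈⁅y⁆⇒x≡y c v∈
... | no  _  = contradiction eq λ ()

wt-spike : (c : Fin m) → wt (spike c) ≡ 2
wt-spike {m} c = begin
  wt (spike c)                                 ≡⟨ sum-cong-≗ pointwise ⟩
  sum (λ v → 2 * ι (v ∈? ⁅ c ⁆))               ≡⟨ *-distribˡ-sum 2 (λ v → ι (v ∈? ⁅ c ⁆)) ⟨
  2 * sum (λ v → ι (v ∈? ⁅ c ⁆))               ≡⟨ cong (2 *_) (∣∣≡sum ⁅ c ⁆) ⟨
  2 * ∣ ⁅ c ⁆ ∣                                ≡⟨ cong (2 *_) (∣⁅x⁆∣≡1 c) ⟩
  2                                            ∎
  where
  open ≡-Reasoning
  pointwise : ∀ v → toℕ (spike c v) ≡ 2 * ι (v ∈? ⁅ c ⁆)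
  pointwise v with v ∈? ⁅ c ⁆
  ... | yes _ = refl
  ... | no  _ = refl

module _ (H : Graph m) where

  open Graph H

  -- Meant for a copy without outside help: the 2 at `c` serves the neighbours of `c`, and every
  -- other vertex takes care of itself with a 1.
  center : Fin m → Fin m → Fin 3
  center c v = if does (v ∈? ⁅ c ⁆) then 2F else if does (v ∈? N H c) then 0F else 1F

  center-self : ∀ c → center c c ≡ 2F
  center-self c rewrite dec-true (c ∈? ⁅ c ⁆) (x∈⁅x⁆ c) = refl

  center≡2 : ∀ {c v} → center c v ≡ 2F → v ≡ c
  center≡2 {c} {v} eq with v ∈? ⁅ c ⁆ | v ∈? N H c
  ... | yes v∈ | _     = x∈⁅y⁆⇒x≡y c v∈
  ... | no  _  | yes _ = contradiction eq λ ()
  ... | no  _  | no  _ = contradiction eq λ ()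

  center≡0 : ∀ {c v} → center c v ≡ 0F → Adj c v
  center≡0 {c} {v} eq with v ∈? ⁅ c ⁆ | v ∈? N H c
  ... | yes _ | _      = contradiction eq λ ()
  ... | no  _ | yes v∈ = ∈N⁻ H v∈
  ... | no  _ | no  _  = contradiction eq λ ()

  private
    sum-1+ι : ∀ c → sum (λ v → 1 + ι (v ∈? ⁅ c ⁆)) ≡ suc m
    sum-1+ι c = trans (∑-distrib-+ {m} (λ _ → 1) (λ v → ι (v ∈? ⁅ c ⁆)))
      (trans (cong₂ _+_ (sum-one m) (trans (sym (∣∣≡sum ⁅ c ⁆)) (∣⁅x⁆∣≡1 c))) (+-comm m 1))

    sum-+degree : ∀ (g : Fin m → Fin 3) c →
                  sum (λ v → toℕ (g v) + ι (v ∈? N H c)) ≡ wt g + degree H c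
    sum-+degree g c = trans (∑-distrib-+ (toℕ ∘ g) (λ v → ι (v ∈? N H c)))
      (cong (wt g +_) (sym (∣∣≡sum (N H c))))

  -- Adding the indicator of the neighbours of `c` raises their 0 to 1, which leaves the constant 1
  -- with one extra unit at `c`.
  wt-center : ∀ c → wt (center c) + degree H c ≡ suc m
  wt-center c = trans (sym (sum-+degree (center c) c)) (trans (sum-cong-≗ {m} pointwise) (sum-1+ι c))
    where
    pointwise : ∀ v → toℕ (center c v) + ι (v ∈? N H c) ≡ 1 + ι (v ∈? ⁅ c ⁆)
    pointwise v with v ∈? ⁅ c ⁆ | v ∈? N H c
    ... | yes v∈ | yes v∈N = contradiction (∈N⁻ H v∈N) (adj-irrefl (sym (x∈⁅y⁆⇒x≡y c v∈)))
    ... | yes _  | no  _   = refl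
    ... | no  _  | yes _   = refl
    ... | no  _  | no  _   = refl

  -- Otherwise all vertices that `c` does not see have positive labels; with the 2 at `c` and one
  -- unit for each neighbour of `c`, the left side would reach `m` + 1.
  zero-nonneighbour : (g : Fin m → Fin 3) {c : Fin m} → g c ≡ 2F → wt g + degree H c ≤ m →
                      ∃ λ v → v ≢ c × ¬ Adj c v × g v ≡ 0F
  zero-nonneighbour g {c} gc small
    with any? (λ v → ¬? (v Fin.≟ c) ×-dec (¬? (adj? c v) ×-dec (g v Fin.≟ 0F)))
  ... | yes found = found
  ... | no ¬found = contradiction small
    (<⇒≱ (subst₂ _≤_ (sum-1+ι c) (sum-+degree g c) (sum-mono pointwise)))
    where
    pointwise : ∀ v → 1 + ι (v ∈? ⁅ c ⁆) ≤ toℕ (g v) + ι (v ∈? N H c)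
    pointwise v with v ∈? ⁅ c ⁆
    ... | yes v∈ rewrite x∈⁅y⁆⇒x≡y c v∈ | gc = m≤m+n 2 _
    ... | no v∉ with v ∈? N H c
    ...   | yes _ = m≤n+m 1 _
    ...   | no v∉N with g v in eq
    ...     | 0F    = contradiction (v , x∉⁅y⁆⇒x≢y v∉ , v∉N ∘ ∈N⁺ H , eq) ¬found
    ...     | suc _ = s≤s z≤n

-- Labellings of the product, one row for each vertex of G

module _ (G : Graph n) (H : Graph m) where

  -- Curried labellings keep the numbering of pairs by `Fin (n * m)` out of the later arguments.
  RDF : (Fin n → Fin m → Fin 3) → Set
  RDF F = ∀ u v → F u v ≡ 0F → ∃ λ p → LexAdj G H (u , v) p × uncurry F p ≡ 2F

  PRDF : (Fin n → Fin m → Fin 3) → Set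
  PRDF F = ∀ u v → F u v ≡ 0F → ∃! _≡_ λ p → LexAdj G H (u , v) p × uncurry F p ≡ 2F

  PRDF⇒RDF : ∀ {F} → PRDF F → RDF F
  PRDF⇒RDF perfect u v z = let (p , pp , _) = perfect u v z in p , pp

  total : (Fin n → Fin m → Fin 3) → ℕ
  total F = sum (wt ∘ F)

  rows : Labelling (n * m) → Fin n → Fin m → Fin 3
  rows f u v = lookup f (combine u v)

  table : (Fin n → Fin m → Fin 3) → Labelling (n * m)
  table F = tabulate (uncurry F ∘ remQuot {n} m)

  lookup-table : ∀ F p → lookup (table F) p ≡ uncurry F (remQuot {n} m p)
  lookup-table F = lookup∘tabulate (uncurry F ∘ remQuot {n} m)

  lookup-rows : ∀ f p → uncurry (rows f) (remQuot {n} m p) ≡ lookup f p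
  lookup-rows f p = cong (lookup f) (combine-remQuot {n} m p)

  weight-rows : ∀ f → weight f ≡ total (rows f)
  weight-rows f = trans (Vec-sum-map toℕ f) (sum-combine n (toℕ ∘ lookup f))

  weight-table : ∀ F → weight (table F) ≡ total F
  weight-table F = trans (weight-rows (table F)) (sum-cong-≗ λ u → sum-cong-≗ λ v →
    cong toℕ (trans (lookup-table F (combine u v)) (cong (uncurry F) (remQuot-combine u v))))

  rows-RDF : ∀ f → IsRDF (G ∘ᴳ H) f → RDF (rows f)
  rows-RDF f rdf u v z with meetsN⁻ (G ∘ᴳ H) (rdf (combine u v) z)
  ... | q , pq , q∈ = remQuot {n} m q ,
    subst (λ p → LexAdj G H p (remQuot {n} m q)) (remQuot-combine u v) pq ,
    trans (lookup-rows f q) (∈-level⁻ {f = f} q∈)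

  rows-PRDF : ∀ f → IsPRDF (G ∘ᴳ H) f → PRDF (rows f)
  rows-PRDF f prdf u v z with Equivalence.to (∣N∩S∣≡1⇔∃! (G ∘ᴳ H)) (prdf (combine u v) z)
  ... | q , (pq , q∈) , uniq = remQuot {n} m q ,
    (subst (λ p → LexAdj G H p (remQuot {n} m q)) (remQuot-combine u v) pq ,
     trans (lookup-rows f q) (∈-level⁻ {f = f} q∈)) ,
    λ {(x , y)} (xy , eq) → trans
      (cong (remQuot {n} m) (uniq {combine x y}
        (subst₂ (LexAdj G H) (sym (remQuot-combine u v)) (sym (remQuot-combine x y)) xy ,
         ∈-level⁺ {f = f} eq)))
      (remQuot-combine x y)

  table-RDF : ∀ {F} → RDF F → IsRDF (G ∘ᴳ H) (table F)
  table-RDF {F} rdf p z with rdf _ _ (trans (sym (lookup-table F p)) z)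
  ... | (x , y) , adj , eq = meetsN⁺ (G ∘ᴳ H) {p} {combine x y}
    (subst (LexAdj G H (remQuot {n} m p)) (sym (remQuot-combine x y)) adj)
    (∈-level⁺ {f = table F} (trans (lookup-table F (combine x y))
      (trans (cong (uncurry F) (remQuot-combine x y)) eq)))

  table-PRDF : ∀ {F} → PRDF F → IsPRDF (G ∘ᴳ H) (table F)
  table-PRDF {F} prdf p z with prdf _ _ (trans (sym (lookup-table F p)) z)
  ... | (x , y) , (adj , eq) , uniq = Equivalence.from (∣N∩S∣≡1⇔∃! (G ∘ᴳ H) {p})
    (combine x y ,
     (subst (LexAdj G H (remQuot {n} m p)) (sym (remQuot-combine x y)) adj ,
      ∈-level⁺ {f = table F} (trans (lookup-table F (combine x y))
        (trans (cong (uncurry F) (remQuot-combine x y)) eq))) ,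
     λ {q} (pq , q∈) → trans
       (cong (uncurry combine) (uniq (pq , trans (sym (lookup-table F q)) (∈-level⁻ {f = table F} q∈))))
       (combine-remQuot {n} m q))

  -- Perfect labellings are among the Roman dominating ones, so the two minima agree exactly when a
  -- perfect labelling is lightest among all of them.
  γᴿᵖ≡γᴿ⇔ : γᴿᵖ (G ∘ᴳ H) ≡ γᴿ (G ∘ᴳ H) ⇔
            (∃ λ F → PRDF F × (∀ F′ → RDF F′ → total F ≤ total F′))
  γᴿᵖ≡γᴿ⇔ = mk⇔ to from
    where
    K = G ∘ᴳ H

    all : ∀ f → f ∈ᴸ vectors (allFin 3) (n * m)
    all = ∈-vectors ∈-allFin (n * m)

    to : γᴿᵖ K ≡ γᴿ K → ∃ λ F → PRDF F × (∀ F′ → RDF F′ → total F ≤ total F′)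
    -- The constant labelling 1 has no label 0, hence is perfect; this makes the minimum finite.
    to eq with minimum-finite (isPRDF? K) weight all
                 (table (λ _ _ → 1F) , table-PRDF λ _ _ ())
    ... | k , γᴿᵖ≡k with minimum⁻ (isPRDF? K) weight all γᴿᵖ≡k
                       | minimum⁻ (isRDF? K) weight all (trans (sym eq) γᴿᵖ≡k)
    ...   | (f , prdf , refl) , _ | _ , least = rows f , rows-PRDF f prdf , λ F′ rdf →
      subst₂ _≤_ (weight-rows f) (weight-table F′) (least (table F′) (table-RDF rdf))

    from : (∃ λ F → PRDF F × (∀ F′ → RDF F′ → total F ≤ total F′)) → γᴿᵖ K ≡ γᴿ K
    from (F , prdf , least) = trans
      (minimum⁺ (isPRDF? K) weight all
        ((table F , table-PRDF prdf , refl) , λ f p → bound f (PRDF⇒RDF (rows-PRDF f p))))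
      (sym (minimum⁺ (isRDF? K) weight all
        ((table F , table-RDF (PRDF⇒RDF prdf) , refl) , λ f r → bound f (rows-RDF f r))))
      where
      bound : ∀ f → RDF (rows f) → weight (table F) ≤ weight f
      bound f rdf = subst₂ _≤_ (sym (weight-table F)) (sym (weight-rows f)) (least (rows f) rdf)

-- Lower bounds on the weight of a Roman dominating labelling

module _ (G : Graph n) (H : Graph m) (F : Fin n → Fin m → Fin 3) where

  private
    module G = Graph G
    module H = Graph H

  active? : Decidable (λ u → ∃ λ v → F u v ≡ 2F)
  active? u = any? λ v → F u v Fin.≟ 2F

  active : Subset n
  active = ⟦ active? ⟧

  Reached : Fin n → Set
  Reached u = ∃ λ x → G.Adj u x × x ∈ active

  reached? : Decidable Reached
  reached? u = any? λ x → G.adj? u x ×-dec (x ∈? active)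

  private
    lonely? : Decidable (λ u → u ∈ active × ¬ Reached u)
    lonely? u = (u ∈? active) ×-dec ¬? (reached? u)

    full? : Decidable (λ u → u ∉ active × ¬ Reached u)
    full? u = ¬? (u ∈? active) ×-dec ¬? (reached? u)

  -- The rows that see no 2 in a neighbouring row, split by whether they contain a 2 themselves. If
  -- `F` is Roman dominating, a row of `full` cannot contain a 0, whence the name.
  lonely full : Subset n
  lonely = ⟦ lonely? ⟧
  full   = ⟦ full? ⟧

  active⁺ : ∀ {u v} → F u v ≡ 2F → u ∈ active
  active⁺ eq = ∈⟦⟧⁺ active? (_ , eq)

  active⁻ : ∀ {u} → u ∈ active → ∃ λ v → F u v ≡ 2F
  active⁻ = ∈⟦⟧⁻ active?

  lonely⊆active : lonely ⊆ active
  lonely⊆active u∈ = proj₁ (∈⟦⟧⁻ lonely? u∈)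

  lonely⇒unreached : ∀ {u} → u ∈ lonely → ¬ Reached u
  lonely⇒unreached u∈ = proj₂ (∈⟦⟧⁻ lonely? u∈)

  reached⇒∉lonely : ∀ {u} → Reached u → u ∉ lonely
  reached⇒∉lonely r u∈ = lonely⇒unreached u∈ r

  module _ (rdf : RDF G H F) where

    unreached-zero : ∀ {u v} → ¬ Reached u → F u v ≡ 0F → ∃ λ y → H.Adj v y × F u y ≡ 2F
    unreached-zero ¬r z with rdf _ _ z
    ... | (x , y) , inj₁ ux , eq          = contradiction (x , ux , active⁺ eq) ¬r
    ... | (_ , y) , inj₂ (refl , vy) , eq = y , vy , eq

    -- A row lighter than 2 + `k` has a 0 that `c` does not see. No neighbouring row defends it, so
    -- the row itself contains a further 2.
    unreached-active : ∀ {u c k} → ¬ Reached u → F u c ≡ 2F → degree H c + suc k ≤ m →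
                       2 + k ≤ wt (F u) ⊎ ∃ λ y → y ≢ c × F u y ≡ 2F
    unreached-active {u} {c} {k} ¬r uc deg with wt (F u) + degree H c ≤? m
    ... | yes small with zero-nonneighbour H (F u) uc small
    ...   | v , _ , ¬cv , z with unreached-zero ¬r z
    ...     | y , vy , eq = inj₂ (y , (λ { refl → ¬cv (H.adj-sym vy) }) , eq)
    unreached-active {u} {c} {k} ¬r uc deg | no large = inj₁ (+-cancelʳ-≤ (degree H c) _ _ (begin
      2 + k + degree H c       ≡⟨ cong suc (+-comm (suc k) _) ⟩
      suc (degree H c + suc k) ≤⟨ s≤s deg ⟩
      suc m                    ≤⟨ ≰⇒> large ⟩
      wt (F u) + degree H c    ∎))
      where open ≤-Reasoning

    module _ (neighbour : NoIsolated G) (3≤m : 3 ≤ m)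
             (k≤2 : k ≤ 2) (degree≤ : ∀ c → degree H c + suc k ≤ m) where

      private
        -- A local lower bound. As `lonely` lies in `active` and `full` is disjoint from it, the
        -- values are 2, 2 + `k`, 3 or 0.
        bound : Fin n → ℕ
        bound u = (2 * ι (u ∈? active) + k * ι (u ∈? lonely)) + 3 * ι (u ∈? full)

        sum-bound : sum bound ≡ cost k active lonely + 3 * ∣ full ∣
        sum-bound = trans (∑-distrib-+ (λ u → 2 * ι (u ∈? active) + k * ι (u ∈? lonely))
                                       (λ u → 3 * ι (u ∈? full)))
          (cong₂ _+_ (weighted-sum 2 k active lonely)
            (trans (sym (*-distribˡ-sum 3 (λ u → ι (u ∈? full)))) (cong (3 *_) (sym (∣∣≡sum full)))))

        two : ∀ {u v} → F u v ≡ 2F → 2 ≤ wt (F u)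
        two {u} {v} eq = subst (_≤ wt (F u)) (cong toℕ eq) (term≤sum (toℕ ∘ F u) v)

        bound≤-by : ∀ {u a b c} → ι (u ∈? active) ≡ a → ι (u ∈? lonely) ≡ b → ι (u ∈? full) ≡ c →
                    (2 * a + k * b) + 3 * c ≤ wt (F u) → bound u ≤ wt (F u)
        bound≤-by refl refl refl le = le

        bound-of-dec : ∀ {u} → Dec (u ∈ active) → Dec (Reached u) → bound u ≤ wt (F u)
        bound-of-dec {u} (yes u∈) (yes r) = bound≤-by
          (ι-yes (u ∈? active) u∈)
          (ι-no (u ∈? lonely) (reached⇒∉lonely r))
          (ι-no (u ∈? full) λ u∈f → proj₂ (∈⟦⟧⁻ full? u∈f) r)
          (subst (_≤ wt (F u)) (value k) (two (proj₂ (active⁻ u∈))))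
          where
          value : ∀ k → 2 ≡ (2 * 1 + k * 0) + 3 * 0
          value = solve-∀
        bound-of-dec {u} (yes u∈) (no ¬r) = bound≤-by
          (ι-yes (u ∈? active) u∈)
          (ι-yes (u ∈? lonely) (∈⟦⟧⁺ lonely? (u∈ , ¬r)))
          (ι-no (u ∈? full) λ u∈f → proj₁ (∈⟦⟧⁻ full? u∈f) u∈)
          (subst (_≤ wt (F u)) (value k) (two+k (active⁻ u∈)))
          where
          value : ∀ k → 2 + k ≡ (2 * 1 + k * 1) + 3 * 0
          value = solve-∀
          two+k : (∃ λ v → F u v ≡ 2F) → 2 + k ≤ wt (F u)
          two+k (c , uc) with unreached-active ¬r uc (degree≤ c)
          ... | inj₁ le             = le
          -- Two labels 2 weigh 4, which is enough because `k` is at most 2.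
          ... | inj₂ (y , y≢c , uy) = ≤-trans (+-monoʳ-≤ 2 k≤2)
            (subst (_≤ wt (F u)) (cong₂ (λ i j → toℕ i + toℕ j) uy uc) (pair≤sum (toℕ ∘ F u) y≢c))
        bound-of-dec {u} (no u∉) (yes r) = bound≤-by
          (ι-no (u ∈? active) u∉)
          (ι-no (u ∈? lonely) (u∉ ∘ lonely⊆active))
          (ι-no (u ∈? full) λ u∈f → proj₂ (∈⟦⟧⁻ full? u∈f) r)
          (subst (_≤ wt (F u)) (value k) z≤n)
          where
          value : ∀ k → 0 ≡ (2 * 0 + k * 0) + 3 * 0
          value = solve-∀
        bound-of-dec {u} (no u∉) (no ¬r) = bound≤-by
          (ι-no (u ∈? active) u∉)
          (ι-no (u ∈? lonely) (u∉ ∘ lonely⊆active))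
          (ι-yes (u ∈? full) (∈⟦⟧⁺ full? (u∉ , ¬r)))
          -- A row of weight below `m` would have a 0, whose defender would make `u` active; hence
          -- the weight is at least `m`, and so at least 3.
          (subst (_≤ wt (F u)) (value k) (≤-trans 3≤m (≮⇒≥ λ small → no-zero (zero-value small))))
          where
          value : ∀ k → 3 ≡ (2 * 0 + k * 0) + 3 * 1
          value = solve-∀
          no-zero : ¬ (∃ λ v → F u v ≡ 0F)
          no-zero (v , z) with unreached-zero ¬r z
          ... | y , _ , uy = u∉ (active⁺ uy)

        bound≤ : ∀ u → bound u ≤ wt (F u)
        bound≤ u = bound-of-dec (u ∈? active) (reached? u)

        -- A full copy has no label 0, so it weighs at least 3: trading it for a neighbour,
        -- at cost 2, is a strict gain.
        support : Subset n
        support = active ∪ image (proj₁ ∘ neighbour) full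

        support-cover : Cover G support lonely
        support-cover = (λ u∈ → x∈p∪q⁺ (inj₁ (lonely⊆active u∈))) , reach
          where
          reach : ∀ u → u ∉ lonely → ∃ λ x → G.Adj u x × x ∈ support
          reach u u∉ with reached? u
          ... | yes (x , ux , x∈) = x , ux , x∈p∪q⁺ (inj₁ x∈)
          ... | no ¬r = proj₁ (neighbour u) , proj₂ (neighbour u) ,
            x∈p∪q⁺ (inj₂ (∈-image (proj₁ ∘ neighbour)
              (∈⟦⟧⁺ full? ((λ u∈ → u∉ (∈⟦⟧⁺ lonely? (u∈ , ¬r))) , ¬r))))

        support-cost : cost k support lonely ≤ cost k active lonely + 2 * ∣ full ∣
        support-cost = begin
          2 * ∣ support ∣ + k * ∣ lonely ∣             ≤⟨ +-monoˡ-≤ _ (*-monoʳ-≤ 2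
            (≤-trans (∣p∪q∣≤∣p∣+∣q∣ active _) (+-monoʳ-≤ ∣ active ∣ (∣image∣≤ (proj₁ ∘ neighbour) full)))) ⟩
          2 * (∣ active ∣ + ∣ full ∣) + k * ∣ lonely ∣ ≡⟨ rearrange ∣ active ∣ ∣ full ∣ (k * ∣ lonely ∣) ⟩
          cost k active lonely + 2 * ∣ full ∣          ∎
          where
          open ≤-Reasoning
          rearrange : ∀ a f l → 2 * (a + f) + l ≡ 2 * a + l + 2 * f
          rearrange = solve-∀

        bound≤total : cost k active lonely + 3 * ∣ full ∣ ≤ total G H F
        bound≤total = subst (_≤ total G H F) sum-bound (sum-mono bound≤)

      -- The lower bound on `γᴿ`: rows of `full` are paid for with 3 each, and enlarging the support
      -- in their place costs at most 2 each.
      cover-below : ∃₂ λ S B → Cover G S B × cost k S B ≤ total G H F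
      cover-below = support , lonely , support-cover , ≤-trans support-cost
        (≤-trans (+-monoʳ-≤ (cost k active lonely) (*-monoˡ-≤ ∣ full ∣ (n≤1+n 2))) bound≤total)

      module _ (least : ∀ S B → Cover G S B → total G H F ≤ cost k S B) where

        private
          ∣full∣≤0 : ∣ full ∣ ≤ 0
          -- The total is at least the cost of `active` and `lonely` plus three times the size of
          -- `full`, and by minimality at most the same cost plus twice that size.
          ∣full∣≤0 = +-cancelʳ-≤ (2 * ∣ full ∣) _ _ (+-cancelˡ-≤ (cost k active lonely) _ _
            (≤-trans bound≤total (≤-trans (least support lonely support-cover) support-cost)))

          ∉full : ∀ {u} → u ∉ full
          ∉full u∈ = contradiction ∣full∣≤0 (<⇒≱ (∈⇒0<∣∣ u∈))

        ∉lonely⇒reached : ∀ {u} → u ∉ lonely → Reached u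
        ∉lonely⇒reached {u} u∉ with reached? u
        ... | yes r = r
        ... | no ¬r = contradiction (∈⟦⟧⁺ full? ((λ u∈ → u∉ (∈⟦⟧⁺ lonely? (u∈ , ¬r))) , ¬r)) ∉full

        tight-cover : Cover G active lonely
        tight-cover = lonely⊆active , λ u u∉ → ∉lonely⇒reached u∉

        private
          total≤bound : total G H F ≤ sum bound
          total≤bound = subst (total G H F ≤_) (sym sum-bound)
            (≤-trans (least active lonely tight-cover) (m≤m+n _ _))

        -- The row bounds add up to a cost that the total does not exceed, so rigidity makes every
        -- row attain its bound.
        tight-weight : ∀ u → wt (F u) ≡ 2 * ι (u ∈? active) + k * ι (u ∈? lonely)
        tight-weight u = begin
          wt (F u)                                       ≡⟨ sum-mono-rigid bound≤ total≤bound u ⟨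
          bound u                                        ≡⟨ cong (λ i → 2 * ι (u ∈? active) + k * ι (u ∈? lonely) + 3 * i)
                                                              (ι-no (u ∈? full) ∉full) ⟩
          2 * ι (u ∈? active) + k * ι (u ∈? lonely) + 0  ≡⟨ +-identityʳ _ ⟩
          2 * ι (u ∈? active) + k * ι (u ∈? lonely)      ∎
          where open ≡-Reasoning

        tight-cost : cost k active lonely ≤ total G H F
        tight-cost = ≤-trans (m≤m+n _ _) bound≤total

-- Perfect labellings of least weight

module _ {G : Graph n} {H : Graph m} {F : Fin n → Fin m → Fin 3} (prdf : PRDF G H F)
         (neighbour : NoIsolated G) (3≤m : 3 ≤ m)
         (k≤2 : k ≤ 2) (degree≤ : ∀ c → degree H c + suc k ≤ m)
         (least : ∀ S B → Cover G S B → total G H F ≤ cost k S B) where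

  private
    module G = Graph G
    module H = Graph H
    rdf = PRDF⇒RDF G H prdf
    S = active G H F
    B = lonely G H F

    weight-is : ∀ u → wt (F u) ≡ 2 * ι (u ∈? S) + k * ι (u ∈? B)
    weight-is = tight-weight G H F rdf neighbour 3≤m k≤2 degree≤ least

    weight-reached : ∀ {u} → u ∉ B → wt (F u) ≤ 2
    weight-reached {u} u∉ = subst (_≤ 2)
      (sym (trans (weight-is u) (trans (cong (λ i → 2 * ι (u ∈? S) + k * i) (ι-no (u ∈? B) u∉))
        (trans (cong (2 * ι (u ∈? S) +_) (*-zeroʳ k)) (+-identityʳ _)))))
      (*-monoʳ-≤ 2 (ι≤1 (u ∈? S)))

    zero-in-row : ∀ {u} → u ∉ B → ∃ λ v → F u v ≡ 0F
    zero-in-row u∉ = zero-value (≤-trans (s≤s (weight-reached u∉)) 3≤m)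

    same-two : ∀ {u v p q} → F u v ≡ 0F →
               LexAdj G H (u , v) p → uncurry F p ≡ 2F → LexAdj G H (u , v) q → uncurry F q ≡ 2F → p ≡ q
    same-two {u} {v} z up p2 uq q2 =
      let (_ , _ , uniq) = prdf u v z in trans (sym (uniq (up , p2))) (uniq (uq , q2))

    -- A row outside `B` weighs at most 2, less than `m`, and so contains a 0. That 0 sees a 2 over
    -- every neighbour of `u` in `S`, and perfection allows only one.
    unique-neighbour : ∀ u → u ∉ B → ∃! _≡_ λ x → G.Adj u x × x ∈ S
    unique-neighbour u u∉ =
      let (x , ux , x∈) = ∉lonely⇒reached G H F rdf neighbour 3≤m k≤2 degree≤ least u∉
          (v , z)       = zero-in-row u∉
          (y , xy)      = active⁻ G H F x∈
      in x , (ux , x∈) , λ {x′} (ux′ , x′∈) →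
           let (y′ , xy′) = active⁻ G H F x′∈
           in cong proj₁ (same-two {u} {v} {x , y} {x′ , y′} z (inj₁ ux) xy (inj₁ ux′) xy′)

    perfect : PerfectCover G S B
    perfect = lonely⊆active G H F , unique-neighbour ,
      λ u x u∈ ux x∈ → lonely⇒unreached G H F u∈ (x , ux , x∈)

    -- A vertex of S ∖ B carries a single 2, so an H-neighbour of that 2 is labelled 0;
    -- it would see a second 2 in the copy of the S-neighbour.
    all-lonely : NoIsolated H → S ⊆ B
    all-lonely neighbourᴴ {u} u∈S = decidable-stable (u ∈? B) λ u∉B →
      let (x , (ux , x∈S) , _) = unique-neighbour u u∉B
          (c , uc) = active⁻ G H F u∈S
          (v , cv) = neighbourᴴ c
          (y , xy) = active⁻ G H F x∈S
          2+uv≤2   = ≤-trans (subst (λ i → toℕ i + toℕ (F u v) ≤ wt (F u)) uc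
                       (pair≤sum (toℕ ∘ F u) {c} {v} λ c≡v → H.adj-irrefl c≡v cv)) (weight-reached u∉B)
          uv≡0     = Fin.toℕ-injective (n≤0⇒n≡0 (+-cancelˡ-≤ 2 _ _ 2+uv≤2))
          u≡x      = cong proj₁ (same-two {u} {v} {u , c} {x , y} uv≡0
                       (inj₂ (refl , H.adj-sym cv)) uc (inj₁ ux) xy)
      in G.adj-irrefl u≡x ux

    -- A row over `B` weighs exactly 2 + `k`. When all degrees are so small that a single 2 would
    -- force weight 2 + `l`, the row must contain two labels 2, and these spoil perfection in a
    -- neighbouring row.
    none-lonely : ∀ l → k < l → (∀ c → degree H c + suc l ≤ m) → ∀ u → u ∉ B
    none-lonely l k<l degree≤ˡ u u∈B =
      let (c , uc) = active⁻ G H F u∈S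
      in [ too-heavy , two-twos c uc ]′
           (unreached-active G H F rdf (lonely⇒unreached G H F u∈B) uc (degree≤ˡ c)) (u , u∈S)
      where
      u∈S : u ∈ S
      u∈S = lonely⊆active G H F u∈B

      too-heavy : 2 + l ≤ wt (F u) → Empty S
      too-heavy large = contradiction k<l (≤⇒≯ (+-cancelˡ-≤ 2 _ _ (≤-trans large
        (≤-reflexive (trans (weight-is u) (trans
          (cong₂ (λ i j → 2 * i + k * j) (ι-yes (u ∈? S) u∈S) (ι-yes (u ∈? B) u∈B))
          (cong (2 +_) (*-identityʳ k))))))))

      two-twos : ∀ c → F u c ≡ 2F → (∃ λ y → y ≢ c × F u y ≡ 2F) → Empty S
      two-twos c uc (y , y≢c , uy) _ =
        -- Any neighbour `x` of `u` is reached from `u`, so its row has a 0, and this 0 sees both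
        -- labels 2 over `u`.
        let (x , ux) = neighbour u
            xu       = G.adj-sym ux
            (v , z)  = zero-in-row {x} (reached⇒∉lonely G H F (u , xu , u∈S))
        in y≢c (cong proj₂ (same-two {x} {v} {u , y} {u , c} z (inj₁ xu) uy (inj₁ xu) uc))

  perfect-cover-below : ∃₂ λ S B → PerfectCover G S B × cost k S B ≤ total G H F ×
                        (NoIsolated H → S ⊆ B) ×
                        (∀ l → k < l → (∀ c → degree H c + suc l ≤ m) → ∀ u → u ∉ B)
  perfect-cover-below = S , B , perfect ,
    tight-cost G H F rdf neighbour 3≤m k≤2 degree≤ least , all-lonely , none-lonely

-- Labellings built from covers

module _ (G : Graph n) (H : Graph m) (c c₀ : Fin m) (S B : Subset n) where

  private
    module G = Graph G
    module H = Graph H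

  -- A `c` of maximum degree makes the rows over `B` cheap. An isolated `c₀` hides the 2 of a row
  -- over `S ─ B` from the zeros of its own row.
  label : Fin n → Fin m → Fin 3
  label u v = if does (u ∈? B) then center H c v else if does (u ∈? S) then spike c₀ v else 0F

  mark : Fin n → Fin m
  mark u = if does (u ∈? B) then c else c₀

  module _ (B⊆S : B ⊆ S) where

    private
      label-mark : ∀ {u} → u ∈ S → label u (mark u) ≡ 2F
      label-mark {u} u∈S with u ∈? B
      ... | yes _ = center-self H c
      ... | no  _ rewrite dec-true (u ∈? S) u∈S = spike-self c₀

      label≡2 : ∀ {u v} → label u v ≡ 2F → u ∈ S × v ≡ mark u
      label≡2 {u} {v} eq with u ∈? B
      ... | yes u∈B = B⊆S u∈B , center≡2 H eq
      ... | no  _ with u ∈? S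
      ...   | yes u∈S = u∈S , spike≡2 eq
      ...   | no  _   = contradiction eq λ ()

      mark-S∖B : ∀ {u} → u ∉ B → mark u ≡ c₀
      mark-S∖B {u} u∉B rewrite dec-false (u ∈? B) u∉B = refl

      label-B≡0 : ∀ {u v} → u ∈ B → label u v ≡ 0F → H.Adj v (mark u)
      label-B≡0 {u} {v} u∈B z rewrite dec-true (u ∈? B) u∈B = H.adj-sym (center≡0 H z)

    label-total : degree H c + suc k ≡ m → total G H label ≡ cost k S B
    label-total {k} deg = trans (sum-cong-≗ row) (weighted-sum 2 k S B)
      where
      wt-c : wt (center H c) ≡ 2 + k
      wt-c = +-cancelʳ-≡ (degree H c) _ _ (trans (wt-center H c)
        (trans (cong suc (sym deg)) (cong suc (+-comm (degree H c) (suc k)))))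
      row : ∀ u → wt (label u) ≡ 2 * ι (u ∈? S) + k * ι (u ∈? B)
      row u with u ∈? B
      ... | yes u∈B rewrite dec-true (u ∈? S) (B⊆S u∈B) = trans wt-c (cong (2 +_) (sym (*-identityʳ k)))
      ... | no  _ with u ∈? S
      ...   | yes _ = trans (wt-spike c₀) (cong (2 +_) (sym (*-zeroʳ k)))
      ...   | no  _ = trans (sum-zero {m} λ _ → refl) (sym (*-zeroʳ k))

    label-RDF : (∀ u → u ∉ B → ∃ λ x → G.Adj u x × x ∈ S) → RDF G H label
    label-RDF reach u v z with u ∈? B
    ... | yes u∈B = (u , mark u) , inj₂ (refl , label-B≡0 u∈B z′) , label-mark (B⊆S u∈B)
      where
      z′ : label u v ≡ 0F
      z′ rewrite dec-true (u ∈? B) u∈B = z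
    ... | no  u∉B = let (x , ux , x∈S) = reach u u∉B in (x , mark x) , inj₁ ux , label-mark x∈S

    -- Over `B`, zeros see only the 2 at `c`, as no neighbouring row has one. Elsewhere the cover
    -- supplies exactly one neighbouring row with a 2, and a 2 in the same row is either absent or
    -- at an isolated vertex.
    label-PRDF : PerfectCover G S B → (S ⊆ B ⊎ Isolated H c₀) → PRDF G H label
    label-PRDF (_ , unique , independent) c₀-harmless u v z with u ∈? B
    ... | yes u∈B = (u , mark u) , (inj₂ (refl , label-B≡0 u∈B z′) , label-mark (B⊆S u∈B)) , uniq
      where
      z′ : label u v ≡ 0F
      z′ rewrite dec-true (u ∈? B) u∈B = z
      uniq : ∀ {p} → LexAdj G H (u , v) p × uncurry label p ≡ 2F → (u , mark u) ≡ p
      uniq {x , y} (inj₁ ux , eq) = contradiction (proj₁ (label≡2 {x} {y} eq)) (independent u x u∈B ux)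
      uniq {_ , y} (inj₂ (refl , _) , eq) = cong (u ,_) (sym (proj₂ (label≡2 {u} {y} eq)))
    ... | no u∉B with unique u u∉B
    ...   | x , (ux , x∈S) , uniq-x = (x , mark x) , (inj₁ ux , label-mark x∈S) , uniq
      where
      uniq : ∀ {p} → LexAdj G H (u , v) p × uncurry label p ≡ 2F → (x , mark x) ≡ p
      uniq {x′ , y} (inj₁ ux′ , eq) with label≡2 {x′} {y} eq
      ... | x′∈S , y≡ with uniq-x (ux′ , x′∈S)
      ...   | refl = cong (x ,_) (sym y≡)
      -- A competing 2 in the row of `u` itself puts `u` into `S ─ B` and sits at `c₀`: impossible
      -- if `S` lies in `B`, and invisible from `v` if `c₀` is isolated.
      uniq {_ , y} (inj₂ (refl , vy) , eq) with label≡2 {u} {y} eq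
      ... | u∈S , y≡ = [ (λ S⊆B → contradiction (S⊆B u∈S) u∉B)
                       , (λ iso → contradiction (H.adj-sym (subst (H.Adj v) (trans y≡ (mark-S∖B u∉B)) vy)) (iso v))
                       ]′ c₀-harmless

-- Extreme degrees and isolated vertices

module _ (H : Graph m) where

  open Graph H

  degree≤Δ : ∀ v → degree H v ≤ Δ H
  degree≤Δ v = All.lookup (ℕ-Extrema.xs≤max 0 (map (degree H) (allFin m))) (∈-map⁺ (degree H) (∈-allFin v))

  Δ-attained : Fin m → ∃ λ c → degree H c ≡ Δ H
  Δ-attained v with ℕ-Extrema.argmax-sel id 0 (map (degree H) (allFin m))
  -- If the default 0 was selected, all degrees vanish and any vertex attains the maximum.
  ... | inj₁ Δ≡0 = v , ≤-antisym (degree≤Δ v) (≤-trans (≤-reflexive Δ≡0) z≤n)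
  ... | inj₂ Δ∈  = let (c , _ , eq) = ∈-map⁻ (degree H) Δ∈ in c , sym eq

  degree≡0⇒isolated : ∀ {v} → degree H v ≡ 0 → Isolated H v
  degree≡0⇒isolated eq x vx = contradiction eq (>⇒≢ (∈⇒0<∣∣ (∈N⁺ H vx)))

  isolated⇒degree≡0 : ∀ {v} → Isolated H v → degree H v ≡ 0
  isolated⇒degree≡0 iso = trans (cong ∣_∣ (Empty-unique λ (x , x∈) → iso x (∈N⁻ H x∈))) (∣⊥∣≡0 m)

  δ-finite : Fin m → ∃ λ k → δ H ≡ [ k ]
  δ-finite v = min-map-finite (degree H) (allFin m) (∈-allFin v)

  δ≡0⇒isolated : δ H ≡ [ 0 ] → ∃ (Isolated H)
  δ≡0⇒isolated eq with min-map⁻ (degree H) (allFin m) eq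
  ... | (v , _ , deg) , _ = v , degree≡0⇒isolated deg

  isolated⇒δ≡0 : ∃ (Isolated H) → δ H ≡ [ 0 ]
  isolated⇒δ≡0 (v , iso) with δ-finite v
  ... | k , eq = trans eq (cong [_] (n≤0⇒n≡0 (subst (k ≤_) (isolated⇒degree≡0 iso)
    (proj₂ (min-map⁻ (degree H) (allFin m) eq) v (∈-allFin v)))))

  1≤δ⇒noIsolated : [ 1 ] ≤∞ δ H → NoIsolated H
  1≤δ⇒noIsolated 1≤δ v with any? (adj? v)
  ... | yes found = found
  ... | no ¬found = contradiction
    (subst ([ 1 ] ≤∞_) (isolated⇒δ≡0 (v , λ x vx → ¬found (x , vx))) 1≤δ) λ { [ () ]≤ }

  δ≡0⊎1≤δ : Fin m → δ H ≡ [ 0 ] ⊎ [ 1 ] ≤∞ δ H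
  δ≡0⊎1≤δ v with δ-finite v
  ... | zero  , eq = inj₁ eq
  ... | suc k , eq = inj₂ (subst ([ 1 ] ≤∞_) (sym eq) [ s≤s z≤n ]≤)

  noIsolated⇒1≤δ : Fin m → NoIsolated H → [ 1 ] ≤∞ δ H
  noIsolated⇒1≤δ v neighbour with δ≡0⊎1≤δ v
  ... | inj₂ 1≤δ = 1≤δ
  ... | inj₁ δ≡0 = let (c , iso) = δ≡0⇒isolated δ≡0
                       (x , cx)  = neighbour c
                   in contradiction cx (iso x)

another : 2 ≤ n → (u : Fin n) → ∃ λ v → v ≢ u
another (s≤s (s≤s _)) zero    = 1F , λ ()
another (s≤s (s≤s _)) (suc u) = 0F , λ ()

connected⇒noIsolated : (G : Graph n) → 2 ≤ n → Connected G → NoIsolated G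
connected⇒noIsolated G 2≤n connected u with another 2≤n u
... | v , v≢u with connected u v
...   | ε      = contradiction refl v≢u
...   | ux ◅ _ = _ , ux

-- Covers compared with packings, domination, couples and `ζ′`

module _ (G : Graph n) where

  open Graph G

  ∈N[]⁺ : ∀ {u z} → Adj u z ⊎ z ≡ u → z ∈ N[_] G u
  ∈N[]⁺ (inj₁ uz)   = x∈p∪q⁺ (inj₁ (∈N⁺ G uz))
  ∈N[]⁺ (inj₂ refl) = x∈p∪q⁺ (inj₂ (x∈⁅x⁆ _))

  ∈N[]⁻ : ∀ {u z} → z ∈ N[_] G u → Adj u z ⊎ z ≡ u
  ∈N[]⁻ {u} z∈ with x∈p∪q⁻ (N G u) ⁅ u ⁆ z∈
  ... | inj₁ z∈N = inj₁ (∈N⁻ G z∈N)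
  ... | inj₂ z∈u = inj₂ (x∈⁅y⁆⇒x≡y u z∈u)

  packing-unique : ∀ {S} → Packing G S → ∀ {u v z} → u ∈ S → v ∈ S → z ∈ N[_] G u → z ∈ N[_] G v → u ≡ v
  packing-unique packing {u} {v} u∈S v∈S z∈u z∈v = decidable-stable (u Fin.≟ v) λ u≢v →
    packing u v u∈S v∈S u≢v (_ , x∈p∩q⁺ (z∈u , z∈v))

  openPacking-unique : ∀ {S} → OpenPacking G S → ∀ {u v z} → u ∈ S → v ∈ S → Adj z u → Adj z v → u ≡ v
  openPacking-unique packing {u} {v} u∈S v∈S zu zv = decidable-stable (u Fin.≟ v) λ u≢v →
    packing u v u∈S v∈S u≢v (_ , x∈p∩q⁺ (∈N⁺ G (adj-sym zu) , ∈N⁺ G (adj-sym zv)))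

  -- The closed neighbourhoods of the vertices of `P` are disjoint, and each of them meets `D`.
  packing≤dominating : ∀ {P D} → Packing G P → Dominating G D → ∣ P ∣ ≤ ∣ D ∣
  packing≤dominating {P} {D} packing dominating = ∣∣≤-by-relation (λ u x → x ∈? N[_] G u) total′
    λ x u v _ u∈P v∈P x∈u x∈v → packing-unique packing u∈P v∈P x∈u x∈v
    where
    total′ : ∀ u → u ∈ P → ∃ λ x → x ∈ D × x ∈ N[_] G u
    total′ u _ with u ∈? D
    ... | yes u∈D = u , u∈D , ∈N[]⁺ (inj₂ refl)
    ... | no  u∉D = let (x , ux , x∈D) = meetsN⁻ G (dominating u u∉D) in x , x∈D , ∈N[]⁺ (inj₁ ux)

  openPacking≤totalDominating : ∀ {P D} → OpenPacking G P → TotalDominating G D → ∣ P ∣ ≤ ∣ D ∣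
  openPacking≤totalDominating {P} {D} packing dominating = ∣∣≤-by-relation adj?
    (λ u _ → let (x , ux , x∈D) = meetsN⁻ G (dominating u) in x , x∈D , ux)
    λ x u v _ u∈P v∈P ux vx → openPacking-unique packing u∈P v∈P (adj-sym ux) (adj-sym vx)

  perfectDominating⇒dominating : ∀ {S} → PerfectDominating G S → Dominating G S
  perfectDominating⇒dominating perfect v v∉S =
    let (x , (vx , x∈S) , _) = Equivalence.to (∣N∩S∣≡1⇔∃! G) (perfect v v∉S) in meetsN⁺ G vx x∈S

  cover⇒dominating : ∀ {S B} → Cover G S B → Dominating G S
  cover⇒dominating (B⊆S , reach) u u∉S =
    let (x , ux , x∈S) = reach u (u∉S ∘ B⊆S) in meetsN⁺ G ux x∈S

  totalDominating⇒cover : ∀ {D} → TotalDominating G D → Cover G D ⊥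
  totalDominating⇒cover dominating = (λ u∈ → contradiction u∈ ∉⊥) , λ u _ → meetsN⁻ G (dominating u)

  cover⇒totalDominating : ∀ {D} → Cover G D ⊥ → TotalDominating G D
  cover⇒totalDominating (_ , reach) u = let (x , ux , x∈D) = reach u ∉⊥ in meetsN⁺ G ux x∈D

  -- A common neighbour of two vertices of `S` is outside `B`, since vertices of `B` have no
  -- neighbour in `S`; so its neighbour in `S` is unique.
  perfect⇒openPacking : ∀ {S B} → PerfectCover G S B → OpenPacking G S
  perfect⇒openPacking {S} {B} (_ , unique , independent) u v u∈S v∈S u≢v (z , z∈) =
    let (z∈u , z∈v) = x∈p∩q⁻ (N G u) (N G v) z∈
        zu = adj-sym (∈N⁻ G z∈u)
        zv = adj-sym (∈N⁻ G z∈v)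
        (_ , _ , uniq) = unique z (λ z∈B → independent z u z∈B zu u∈S)
    in u≢v (trans (sym (uniq (zu , u∈S))) (uniq (zv , v∈S)))

  openPacking⇒perfect : ∀ {S B} → OpenPacking G S → Cover G S B →
                        (∀ u x → u ∈ B → Adj u x → x ∉ S) → PerfectCover G S B
  openPacking⇒perfect packing (B⊆S , reach) independent = B⊆S ,
    (λ u u∉B → let (x , ux , x∈S) = reach u u∉B in
      x , (ux , x∈S) , λ {_} (uy , y∈S) → openPacking-unique packing x∈S y∈S ux uy) ,
    independent

  perfect⇒perfectDominating : ∀ {S} → PerfectCover G S S → PerfectDominating G S
  perfect⇒perfectDominating (_ , unique , _) v v∉S = Equivalence.from (∣N∩S∣≡1⇔∃! G) (unique v v∉S)

  -- For `B` equal to `S` the set is independent as well as an open packing, so closed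
  -- neighbourhoods are disjoint too.
  perfect⇒packing : ∀ {S} → PerfectCover G S S → Packing G S
  perfect⇒packing {S} perfect@(_ , _ , independent) u v u∈S v∈S u≢v (z , z∈) =
    let (z∈u , z∈v) = x∈p∩q⁻ (N[_] G u) (N[_] G v) z∈ in disjoint (∈N[]⁻ z∈u) (∈N[]⁻ z∈v)
    where
    disjoint : Adj u z ⊎ z ≡ u → ¬ (Adj v z ⊎ z ≡ v)
    disjoint (inj₁ uz)   (inj₁ vz)   =
      perfect⇒openPacking perfect u v u∈S v∈S u≢v (z , x∈p∩q⁺ (∈N⁺ G uz , ∈N⁺ G vz))
    disjoint (inj₁ uz)   (inj₂ refl) = independent u z u∈S uz v∈S
    disjoint (inj₂ refl) (inj₁ vz)   = independent v z v∈S vz u∈S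
    disjoint (inj₂ refl) (inj₂ refl) = u≢v refl

  packing⇒perfect : ∀ {S} → Packing G S → Dominating G S → PerfectCover G S S
  packing⇒perfect packing dominating = id ,
    (λ u u∉S → let (x , ux , x∈S) = meetsN⁻ G (dominating u u∉S) in
      x , (ux , x∈S) , λ {_} (uy , y∈S) →
        packing-unique packing x∈S y∈S (∈N[]⁺ (inj₁ (adj-sym ux))) (∈N[]⁺ (inj₁ (adj-sym uy)))) ,
    λ u x u∈S ux x∈S → adj-irrefl
      (packing-unique packing u∈S x∈S (∈N[]⁺ (inj₁ ux)) (∈N[]⁺ (inj₂ refl))) ux

  -- If a vertex of B had a neighbour in S, it could be dropped from B.
  cheapest⇒independent : ∀ {S B} → Cover G S B → Cheapest G (suc k) S B → ∀ u x → u ∈ B → Adj u x → x ∉ S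
  cheapest⇒independent {k} {S} {B} (B⊆S , reach) cheapest u x u∈B ux x∈S =
    <⇒≱ (+-monoʳ-< (2 * ∣ S ∣) (*-monoʳ-< (suc k) (x∈p⇒∣p-x∣<∣p∣ u∈B)))
        (cheapest S (B - u) ((B⊆S ∘ p─q⊆p B ⁅ u ⁆) , reach′))
    where
    reach′ : ∀ v → v ∉ B - u → ∃ λ y → Adj v y × y ∈ S
    reach′ v v∉ with v Fin.≟ u
    ... | yes refl = x , ux , x∈S
    ... | no  v≢u  = reach v λ v∈B → v∉ (x∈p∧x≢y⇒x∈p-y v∈B v≢u)

  cost-⊥ : ∀ k (S : Subset n) → cost k S ⊥ ≡ 2 * ∣ S ∣
  cost-⊥ k S = trans (cong (λ b → 2 * ∣ S ∣ + k * b) (∣⊥∣≡0 n))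
    (trans (cong (2 * ∣ S ∣ +_) (*-zeroʳ k)) (+-identityʳ _))

  -- Adding to `S` one neighbour for each vertex of `B` costs 2 apiece, exactly the surcharge on `B`
  -- at `k` = 2.
  totalize : NoIsolated G → ∀ {S B} → Cover G S B → ∃ λ D → Cover G D ⊥ × 2 * ∣ D ∣ ≤ cost 2 S B
  totalize neighbour {S} {B} (B⊆S , reach) = D , ((λ u∈ → contradiction u∈ ∉⊥) , reach′) ,
    subst (2 * ∣ D ∣ ≤_) (*-distribˡ-+ 2 ∣ S ∣ ∣ B ∣)
      (*-monoʳ-≤ 2 (≤-trans (∣p∪q∣≤∣p∣+∣q∣ S _) (+-monoʳ-≤ ∣ S ∣ (∣image∣≤ φ B))))
    where
    φ : Fin n → Fin n
    φ = proj₁ ∘ neighbour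
    D : Subset n
    D = S ∪ image φ B
    reach′ : ∀ u → u ∉ ⊥ → ∃ λ x → Adj u x × x ∈ D
    reach′ u _ with u ∈? B
    ... | yes u∈B = φ u , proj₂ (neighbour u) , x∈p∪q⁺ (inj₂ (∈-image φ u∈B))
    ... | no  u∉B = let (x , ux , x∈S) = reach u u∉B in x , ux , x∈p∪q⁺ (inj₁ x∈S)

  -- A couple `(A , B)` corresponds to the pair `A ∪ B`, `B`: the weight 3 on `B` splits into 2 for
  -- membership in `S` and a surcharge of 1.
  coupleWeight-─ : ∀ {S B : Subset n} → B ⊆ S → coupleWeight (S ─ B , B) ≡ cost 1 S B
  coupleWeight-─ {S} {B} B⊆S = trans (rearrange ∣ S ─ B ∣ ∣ B ∣)
    (cong (λ s → 2 * s + 1 * ∣ B ∣) (∣p─q∣+∣q∣≡∣p∣ B⊆S))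
    where
    rearrange : ∀ a b → 2 * a + 3 * b ≡ 2 * (a + b) + 1 * b
    rearrange = solve-∀

  couple⇒cover : ∀ {A B} → DominatingCouple G (A , B) → Cover G (A ∪ B) B
  couple⇒cover {A} {B} (_ , dominating) = q⊆p∪q A B , λ u u∉B → meetsN⁻ G (dominating u u∉B)

  couple-cost : ∀ {A B} → DominatingCouple G (A , B) → coupleWeight (A , B) ≡ cost 1 (A ∪ B) B
  couple-cost {A} {B} (disjoint , _) =
    trans (cong (λ A → coupleWeight (A , B)) (sym (p∪q─q≡p disjoint))) (coupleWeight-─ (q⊆p∪q A B))

  cover⇒couple : ∀ {S B} → Cover G S B → DominatingCouple G (S ─ B , B)
  cover⇒couple {S} {B} (B⊆S , reach) =
    (λ (x , x∈) → let (x∈S─B , x∈B) = x∈p∩q⁻ (S ─ B) B x∈ in x∈p─q⇒x∉q x∈S─B x∈B) ,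
    λ u u∉B → let (x , ux , x∈S) = reach u u∉B in
      meetsN⁺ G ux (subst (x ∈_) (sym (p─q∪q≡p B⊆S)) x∈S)

  ζ-couple⇒cheapest : ∀ {A B} → ζ-Couple G (A , B) → Cheapest G 1 (A ∪ B) B
  ζ-couple⇒cheapest {A} {B} (couple , eq) S′ B′ cover = subst₂ _≤_ (couple-cost couple)
    (coupleWeight-─ (proj₁ cover))
    (proj₂ (minimum⁻ (dominatingCouple? G) coupleWeight
             (λ (A , B) → ∈-cartesianProduct⁺ (∈-subsets A) (∈-subsets B)) (sym eq))
           (S′ ─ B′ , B′) (cover⇒couple cover))

  cheapest⇒ζ-couple : ∀ {S B} → Cover G S B → Cheapest G 1 S B → ζ-Couple G (S ─ B , B)
  cheapest⇒ζ-couple {S} {B} cover cheapest = cover⇒couple cover ,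
    sym (minimum⁺ (dominatingCouple? G) coupleWeight
          (λ (A , B) → ∈-cartesianProduct⁺ (∈-subsets A) (∈-subsets B))
          ((_ , cover⇒couple cover , refl) , λ (A , B) couple →
            subst₂ _≤_ (sym (coupleWeight-─ (proj₁ cover))) (sym (couple-cost couple))
              (cheapest (A ∪ B) B (couple⇒cover couple))))

  γₜ-finite : NoIsolated G → ∃ λ g → γₜ G ≡ [ g ]
  γₜ-finite neighbour = minimum-finite (totalDominating? G) ∣_∣ ∈-subsets
    (⊤ , λ u → meetsN⁺ G (proj₂ (neighbour u)) ∈⊤)

  -- Total dominating sets are the covers with empty `B`, and by `totalize` these suffice to reach
  -- the minimum.
  cheapest-cost : NoIsolated G → ∀ {S B g} → Cover G S B → Cheapest G 2 S B → γₜ G ≡ [ g ] → cost 2 S B ≡ 2 * g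
  cheapest-cost neighbour {S} {B} cover cheapest γₜ≡g
    with minimum⁻ (totalDominating? G) ∣_∣ ∈-subsets γₜ≡g
  ... | (D , dominating , refl) , least = ≤-antisym
    (subst (cost 2 S B ≤_) (cost-⊥ 2 D) (cheapest D ⊥ (totalDominating⇒cover dominating)))
    (let (D′ , cover′ , D′≤) = totalize neighbour cover
     in ≤-trans (*-monoʳ-≤ 2 (least D′ (cover⇒totalDominating cover′))) D′≤)

  2γₜ⇒cheapest : NoIsolated G → ∀ S B {g} → cost 2 S B ≡ 2 * g → γₜ G ≡ [ g ] → Cheapest G 2 S B
  2γₜ⇒cheapest neighbour S B eq γₜ≡g S′ B′ cover = subst (_≤ cost 2 S′ B′) (sym eq)
    (let (D , coverᴰ , D≤) = totalize neighbour cover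
         (_ , least)       = minimum⁻ (totalDominating? G) ∣_∣ ∈-subsets γₜ≡g
     in ≤-trans (*-monoʳ-≤ 2 (least D (cover⇒totalDominating coverᴰ))) D≤)

  private
    isolated? : ∀ S → Decidable (λ v → v ∈ S × ¬ Nonempty (N G v ∩ S))
    isolated? S v = (v ∈? S) ×-dec ¬? (nonempty? (N G v ∩ S))

  isolated⊆ : ∀ S → isolated G S ⊆ S
  isolated⊆ S x∈ = proj₁ (∈⟦⟧⁻ (isolated? S) x∈)

  isolated⇒∉ : ∀ {S} u x → u ∈ isolated G S → Adj u x → x ∉ S
  isolated⇒∉ {S} u x u∈ ux x∈S = proj₂ (∈⟦⟧⁻ (isolated? S) u∈) (meetsN⁺ G ux x∈S)

  dominating⇒cover : ∀ {S} → Dominating G S → Cover G S (isolated G S)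
  dominating⇒cover {S} dominating = isolated⊆ S , reach
    where
    reach : ∀ u → u ∉ isolated G S → ∃ λ x → Adj u x × x ∈ S
    reach u u∉ with nonempty? (N G u ∩ S) | u ∈? S
    ... | yes meets | _       = meetsN⁻ G meets
    ... | no  _     | no u∉S  = meetsN⁻ G (dominating u u∉S)
    ... | no ¬meets | yes u∈S = contradiction (∈⟦⟧⁺ (isolated? S) (u∈S , ¬meets)) u∉

  -- Vertices of `B` have no neighbour in `S` and all others have one, so `S` determines `B`.
  perfect⇒isolated : ∀ {S B} → PerfectCover G S B → B ≡ isolated G S
  perfect⇒isolated {S} {B} (B⊆S , unique , independent) = ⊆-antisym
    (λ {u} u∈B → ∈⟦⟧⁺ (isolated? S) (B⊆S u∈B , λ meets →
      let (x , ux , x∈S) = meetsN⁻ G meets in independent u x u∈B ux x∈S))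
    (λ {u} u∈ → decidable-stable (u ∈? B) λ u∉B →
      let (x , (ux , x∈S) , _) = unique u u∉B in isolated⇒∉ u x u∈ ux x∈S)

  ζ′-weight : ∀ S → 4 * ∣ isolated G S ∣ + 2 * ∣ nonIsolated G S ∣ ≡ cost 2 S (isolated G S)
  ζ′-weight S = trans (rearrange ∣ isolated G S ∣ ∣ nonIsolated G S ∣)
    (cong (λ s → 2 * s + 2 * ∣ isolated G S ∣) (∣p─q∣+∣q∣≡∣p∣ (isolated⊆ S)))
    where
    rearrange : ∀ i j → 4 * i + 2 * j ≡ 2 * (j + i) + 2 * i
    rearrange = solve-∀

·-finite : ∀ k {l x} → k · x ≡ [ l ] → ∃ λ p → x ≡ [ p ] × k * p ≡ l
·-finite k {x = just p} refl = p , refl , refl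

-- The four cases of the theorem

module _ (G : Graph n) (H : Graph m) (neighbour : NoIsolated G) (3≤m : 3 ≤ m) where

  private
    module G = Graph G
    module H = Graph H

    v₀ : Fin m
    v₀ = Fin.fromℕ< (≤-trans (s≤s z≤n) 3≤m)

    degree-bound : ∀ {k} → Δ H + suc k ≤ m → ∀ c → degree H c + suc k ≤ m
    degree-bound Δ≤ c = ≤-trans (+-monoˡ-≤ _ (degree≤Δ H c)) Δ≤

    cheapest≤RDF : ∀ k S B → k ≤ 2 → Δ H + suc k ≤ m → Cheapest G k S B →
                   ∀ F → RDF G H F → cost k S B ≤ total G H F
    cheapest≤RDF k S B k≤2 Δ≤ cheapest F rdf =
      let (S′ , B′ , cover , cost≤) = cover-below G H F rdf neighbour 3≤m k≤2 (degree-bound Δ≤)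
      in ≤-trans (cheapest S′ B′ cover) cost≤

  isolated-or-none : ∃ (Isolated H) ⊎ NoIsolated H
  isolated-or-none = [ inj₁ ∘ δ≡0⇒isolated H , inj₂ ∘ 1≤δ⇒noIsolated H ]′ (δ≡0⊎1≤δ H v₀)

  -- The common core of the first three cases. With a 2 at a vertex of maximum degree every cover is
  -- realised at its exact cost, so least labellings and cheapest covers have the same weight.
  γᴿᵖ≡γᴿ⇔perfectCover : k ≤ 2 → Δ H + suc k ≡ m →
    γᴿᵖ (G ∘ᴳ H) ≡ γᴿ (G ∘ᴳ H) ⇔
    (∃₂ λ S B → PerfectCover G S B × Cheapest G k S B × (NoIsolated H → S ⊆ B))
  γᴿᵖ≡γᴿ⇔perfectCover {k} k≤2 Δ≡ = mk⇔ (to ∘ Equivalence.to (γᴿᵖ≡γᴿ⇔ G H)) (Equivalence.from (γᴿᵖ≡γᴿ⇔ G H) ∘ from)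
    where
    Δ≤ : Δ H + suc k ≤ m
    Δ≤ = ≤-reflexive Δ≡

    c : Fin m
    c = proj₁ (Δ-attained H v₀)

    degree-c : degree H c + suc k ≡ m
    degree-c = trans (cong (_+ suc k) (proj₂ (Δ-attained H v₀))) Δ≡

    to : (∃ λ F → PRDF G H F × (∀ F′ → RDF G H F′ → total G H F ≤ total G H F′)) →
         ∃₂ λ S B → PerfectCover G S B × Cheapest G k S B × (NoIsolated H → S ⊆ B)
    to (F , prdf , least) =
      let (S , B , perfect , cost≤ , lonely , _) =
            perfect-cover-below {k = k} {G = G} {H} {F} prdf neighbour 3≤m k≤2 (degree-bound Δ≤) least-cover
      in S , B , perfect , (λ S′ B′ cover → ≤-trans cost≤ (least-cover S′ B′ cover)) , lonely
      where
      least-cover : ∀ S B → Cover G S B → total G H F ≤ cost k S B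
      -- Roman domination alone puts no condition on the place of the 2 over `S ─ B`, so `c` serves
      -- there as well.
      least-cover S B (B⊆S , reach) = subst (total G H F ≤_) (label-total G H c c S B B⊆S degree-c)
        (least _ (label-RDF G H c c S B B⊆S reach))

    from : (∃₂ λ S B → PerfectCover G S B × Cheapest G k S B × (NoIsolated H → S ⊆ B)) →
           ∃ λ F → PRDF G H F × (∀ F′ → RDF G H F′ → total G H F ≤ total G H F′)
    from (S , B , perfect@(B⊆S , _) , cheapest , lonely) = build isolated-or-none
      where
      result : ∀ c₀ → S ⊆ B ⊎ Isolated H c₀ →
               ∃ λ F → PRDF G H F × (∀ F′ → RDF G H F′ → total G H F ≤ total G H F′)
      result c₀ harmless = label G H c c₀ S B , label-PRDF G H c c₀ S B B⊆S perfect harmless ,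
        λ F′ rdf → subst (_≤ total G H F′) (sym (label-total G H c c₀ S B B⊆S degree-c))
          (cheapest≤RDF k S B k≤2 Δ≤ cheapest F′ rdf)
      build : ∃ (Isolated H) ⊎ NoIsolated H →
              ∃ λ F → PRDF G H F × (∀ F′ → RDF G H F′ → total G H F ≤ total G H F′)
      -- An isolated vertex of `H`, if there is one, takes the 2 over `S ─ B`; otherwise `S ─ B` is
      -- empty.
      build (inj₁ (c₀ , iso)) = result c₀ (inj₂ iso)
      build (inj₂ noIso)      = result c (inj₁ (lonely noIso))

  module _ (Δ≡ : Δ H + 1 ≡ m) where

    private
      c : Fin m
      c = proj₁ (Δ-attained H v₀)

      -- Since `c` has degree `m` - 1, `center` weighs 2, all of it at `c`. Every other vertex is
      -- labelled 0, hence adjacent to `c`.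
      universal : ∀ v → v ≢ c → H.Adj c v
      universal v v≢c = center≡0 H (Fin.toℕ-injective (n≤0⇒n≡0 (+-cancelˡ-≤ 2 _ _ (begin
        2 + toℕ (center H c v)                   ≡⟨ cong (λ i → toℕ i + toℕ (center H c v)) (center-self H c) ⟨
        toℕ (center H c c) + toℕ (center H c v)  ≤⟨ pair≤sum (toℕ ∘ center H c) (v≢c ∘ sym) ⟩
        wt (center H c)                          ≡⟨ +-cancelʳ-≡ (degree H c) _ _ (trans (wt-center H c) (cong suc m≡)) ⟩
        2                                        ∎))))
        where
        open ≤-Reasoning
        m≡ : m ≡ suc (degree H c)
        m≡ = trans (sym Δ≡) (trans (+-comm (Δ H) 1) (cong suc (sym (proj₂ (Δ-attained H v₀)))))

    universal⇒noIsolated : NoIsolated H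
    universal⇒noIsolated v with v Fin.≟ c
    ... | no v≢c   = c , H.adj-sym (universal v v≢c)
    ... | yes refl = let (w , w≢c) = another (≤-trans (n≤1+n 2) 3≤m) c in w , universal w w≢c

    universal⇒γ≡1 : γ H ≡ [ 1 ]
    universal⇒γ≡1 = minimum⁺ (dominating? H) ∣_∣ ∈-subsets
      ((⁅ c ⁆ , (λ v v∉ → meetsN⁺ H (H.adj-sym (universal v (x∉⁅y⁆⇒x≢y v∉))) (x∈⁅x⁆ c)) , ∣⁅x⁆∣≡1 c) ,
       λ S dominating → 1≤∣S∣ S dominating)
      where
      1≤∣S∣ : ∀ S → Dominating H S → 1 ≤ ∣ S ∣
      1≤∣S∣ S dominating with c ∈? S
      ... | yes c∈S = ∈⇒0<∣∣ c∈S
      ... | no  c∉S = let (_ , _ , x∈S) = meetsN⁻ H (dominating c c∉S) in ∈⇒0<∣∣ x∈S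

    case-i : γᴿᵖ (G ∘ᴳ H) ≡ γᴿ (G ∘ᴳ H) ⇔ (γ H ≡ [ 1 ] × EfficientClosedDomination G)
    case-i = mk⇔
      (λ eq → universal⇒γ≡1 , to (Equivalence.to core eq))
      (λ (_ , efficient) → Equivalence.from core (from efficient))
      where
      core = γᴿᵖ≡γᴿ⇔perfectCover z≤n Δ≡

      to : (∃₂ λ S B → PerfectCover G S B × Cheapest G 0 S B × (NoIsolated H → S ⊆ B)) →
           EfficientClosedDomination G
      to (S , B , perfect , _ , lonely) = S , cover⇒dominating G (perfect⇒cover G perfect) ,
        perfect⇒packing G (subst (PerfectCover G S)
          (⊆-antisym (proj₁ perfect) (lonely universal⇒noIsolated)) perfect)

      from : EfficientClosedDomination G →
             ∃₂ λ S B → PerfectCover G S B × Cheapest G 0 S B × (NoIsolated H → S ⊆ B)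
      from (S , dominating , packing) = S , S , packing⇒perfect G packing dominating ,
        -- At `k` = 0 the cost is twice the size of the dominating set, and no dominating set is
        -- smaller than the packing `S`.
        (λ S′ B′ cover → +-monoˡ-≤ 0 (*-monoʳ-≤ 2
          (packing≤dominating G packing (cover⇒dominating G cover)))) ,
        λ _ → id

  case-ii : Δ H + 2 ≡ m → γᴿᵖ (G ∘ᴳ H) ≡ γᴿ (G ∘ᴳ H) ⇔
            (∃₂ λ A B → ζ-Couple G (A , B) × OpenPacking G (A ∪ B) × ([ 1 ] ≤∞ δ H → A ≡ ⊥))
  case-ii Δ≡ = mk⇔ (to ∘ Equivalence.to core) (Equivalence.from core ∘ from)
    where
    core = γᴿᵖ≡γᴿ⇔perfectCover (s≤s z≤n) Δ≡

    to : (∃₂ λ S B → PerfectCover G S B × Cheapest G 1 S B × (NoIsolated H → S ⊆ B)) →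
         ∃₂ λ A B → ζ-Couple G (A , B) × OpenPacking G (A ∪ B) × ([ 1 ] ≤∞ δ H → A ≡ ⊥)
    to (S , B , perfect@(B⊆S , _) , cheapest , lonely) = S ─ B , B ,
      cheapest⇒ζ-couple G (perfect⇒cover G perfect) cheapest ,
      subst (OpenPacking G) (sym (p─q∪q≡p B⊆S)) (perfect⇒openPacking G perfect) ,
      λ 1≤δ → Empty-unique λ (x , x∈) →
        x∈p─q⇒x∉q x∈ (lonely (1≤δ⇒noIsolated H 1≤δ) (p─q⊆p S B x∈))

    from : (∃₂ λ A B → ζ-Couple G (A , B) × OpenPacking G (A ∪ B) × ([ 1 ] ≤∞ δ H → A ≡ ⊥)) →
           ∃₂ λ S B → PerfectCover G S B × Cheapest G 1 S B × (NoIsolated H → S ⊆ B)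
    from (A , B , couple , packing , A-empty) = A ∪ B , B ,
      -- Minimality of the couple provides the missing clause, that `B` has no neighbour in `A ∪ B`.
      openPacking⇒perfect G packing cover (cheapest⇒independent G {0} cover cheapest) ,
      cheapest ,
      λ noIso x∈ → [ (λ x∈A → contradiction (subst (_ ∈_) (A-empty (noIsolated⇒1≤δ H v₀ noIso)) x∈A) ∉⊥) , id ]′
        (x∈p∪q⁻ A B x∈)
      where
      cover    = couple⇒cover G (proj₁ couple)
      cheapest = ζ-couple⇒cheapest G couple

  case-iii : Δ H + 3 ≡ m → γᴿᵖ (G ∘ᴳ H) ≡ γᴿ (G ∘ᴳ H) ⇔
             ((δ H ≡ [ 0 ] × ζ′ G ≡ 2 · γₜ G) ⊎
              ([ 1 ] ≤∞ δ H × γₜ G ≡ 2 · γᵖ G × 2 · γᵖ G ≡ [ 2 * ρ G ]))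
  case-iii Δ≡ = mk⇔ (to ∘ Equivalence.to core) (Equivalence.from core ∘ from)
    where
    core = γᴿᵖ≡γᴿ⇔perfectCover ≤-refl Δ≡

    g : ℕ
    g = proj₁ (γₜ-finite G neighbour)

    γₜ≡g : γₜ G ≡ [ g ]
    γₜ≡g = proj₂ (γₜ-finite G neighbour)

    cost-diagonal : ∀ (S : Subset n) → cost 2 S S ≡ 2 * (2 * ∣ S ∣)
    cost-diagonal S = double ∣ S ∣
      where
      double : ∀ s → 2 * s + 2 * s ≡ 2 * (2 * s)
      double = solve-∀

    -- By `ζ′-weight`, `ζ′` minimises the same cost over fewer covers, and the cheapest cover is one
    -- of these because it is perfect.
    minimal-ζ′ : ∀ {S B} → PerfectCover G S B → Cheapest G 2 S B → ζ′ G ≡ 2 · γₜ G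
    minimal-ζ′ {S} {B} perfect cheapest = trans
      (minimum⁺ (λ S → openPacking? G S ×-dec dominating? G S) _ ∈-subsets
        ((S , (perfect⇒openPacking G perfect , cover⇒dominating G cover) ,
          trans (ζ′-weight G S) (trans (cong (cost 2 S) (sym (perfect⇒isolated G perfect))) cost≡2g)) ,
         λ S′ (_ , dominating) → subst₂ _≤_ cost≡2g (sym (ζ′-weight G S′))
           (cheapest S′ _ (dominating⇒cover G dominating))))
      (cong (2 ·_) (sym γₜ≡g))
      where
      cover = perfect⇒cover G perfect

      cost≡2g : cost 2 S B ≡ 2 * g
      cost≡2g = cheapest-cost G neighbour cover cheapest γₜ≡g

    -- A dominating packing bounds packings from above and dominating sets from below, which fixes
    -- `ρ` and `γᵖ` at its size; its cost of four times that size is twice `γₜ`.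
    packing-numbers : ∀ {S} → PerfectCover G S S → Cheapest G 2 S S →
                      γₜ G ≡ 2 · γᵖ G × 2 · γᵖ G ≡ [ 2 * ρ G ]
    packing-numbers {S} perfect cheapest =
      trans γₜ≡g (trans (cong [_] g≡) (cong (2 ·_) (sym γᵖ≡))) ,
      trans (cong (2 ·_) γᵖ≡) (cong (λ r → [ 2 * r ]) (sym ρ≡))
      where
      cover = perfect⇒cover G perfect
      packing = perfect⇒packing G perfect

      g≡ : g ≡ 2 * ∣ S ∣
      g≡ = *-cancelˡ-≡ _ _ 2 (trans (sym (cheapest-cost G neighbour cover cheapest γₜ≡g)) (cost-diagonal S))

      γᵖ≡ : γᵖ G ≡ [ ∣ S ∣ ]
      γᵖ≡ = minimum⁺ (perfectDominating? G) ∣_∣ ∈-subsets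
        ((S , perfect⇒perfectDominating G perfect , refl) ,
         λ D dominating → packing≤dominating G packing (perfectDominating⇒dominating G dominating))

      ρ≡ : ρ G ≡ ∣ S ∣
      ρ≡ = maximum⁺ (packing? G) ∣_∣ ∈-subsets (S , packing , refl)
        λ P packing′ → packing≤dominating G packing′ (cover⇒dominating G cover)

    to : (∃₂ λ S B → PerfectCover G S B × Cheapest G 2 S B × (NoIsolated H → S ⊆ B)) →
         (δ H ≡ [ 0 ] × ζ′ G ≡ 2 · γₜ G) ⊎
         ([ 1 ] ≤∞ δ H × γₜ G ≡ 2 · γᵖ G × 2 · γᵖ G ≡ [ 2 * ρ G ])
    to (S , B , perfect , cheapest , lonely) =
      [ (λ δ≡0 → inj₁ (δ≡0 , minimal-ζ′ perfect cheapest))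
      , (λ 1≤δ → inj₂ (1≤δ , diagonal (⊆-antisym (proj₁ perfect) (lonely (1≤δ⇒noIsolated H 1≤δ))) perfect cheapest))
      ]′ (δ≡0⊎1≤δ H v₀)
      where
      diagonal : ∀ {S B} → B ≡ S → PerfectCover G S B → Cheapest G 2 S B →
                 γₜ G ≡ 2 · γᵖ G × 2 · γᵖ G ≡ [ 2 * ρ G ]
      diagonal refl = packing-numbers

    from : (δ H ≡ [ 0 ] × ζ′ G ≡ 2 · γₜ G) ⊎
           ([ 1 ] ≤∞ δ H × γₜ G ≡ 2 · γᵖ G × 2 · γᵖ G ≡ [ 2 * ρ G ]) →
           ∃₂ λ S B → PerfectCover G S B × Cheapest G 2 S B × (NoIsolated H → S ⊆ B)
    from (inj₁ (δ≡0 , ζ′≡)) =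
      -- Since `γₜ` is finite, so is `ζ′`, and a dominating open packing attains it.
      let ((S , (packing , dominating) , weight≡) , _) =
            minimum⁻ (λ S → openPacking? G S ×-dec dominating? G S) _ ∈-subsets (trans ζ′≡ (cong (2 ·_) γₜ≡g))
      in S , isolated G S ,
         openPacking⇒perfect G packing (dominating⇒cover G dominating) (isolated⇒∉ G) ,
         2γₜ⇒cheapest G neighbour S (isolated G S) (trans (sym (ζ′-weight G S)) weight≡) γₜ≡g ,
         λ noIso → let (v , iso) = δ≡0⇒isolated H δ≡0
                       (x , vx)  = noIso v
                   in contradiction vx (iso x)
    -- A minimum perfect dominating set `D`, paired with itself, costs four times `γᵖ`, that is
    -- twice `γₜ`. It is therefore cheapest, and minimality makes `D` independent.
    from (inj₂ (_ , γₜ≡2γᵖ , _)) =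
      let (p , γᵖ≡p , 2p≡g)   = ·-finite 2 (trans (sym γₜ≡2γᵖ) γₜ≡g)
          ((D , perfect , ∣D∣≡p) , _) = minimum⁻ (perfectDominating? G) ∣_∣ ∈-subsets γᵖ≡p
          cover : Cover G D D
          cover = id , λ u u∉D → meetsN⁻ G (perfectDominating⇒dominating G perfect u u∉D)
          cheapest : Cheapest G 2 D D
          cheapest = 2γₜ⇒cheapest G neighbour D D
            (trans (cost-diagonal D) (cong (2 *_) (trans (cong (2 *_) ∣D∣≡p) 2p≡g))) γₜ≡g
      in D , D ,
         (id , (λ u u∉D → Equivalence.to (∣N∩S∣≡1⇔∃! G) (perfect u u∉D)) , cheapest⇒independent G {1} cover cheapest) ,
         cheapest , λ _ → id

  case-iv : Fin n → Δ H + 4 ≤ m → γᴿᵖ (G ∘ᴳ H) ≡ γᴿ (G ∘ᴳ H) ⇔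
            (δ H ≡ [ 0 ] × EfficientOpenDomination G)
  case-iv u₀ Δ≤ = mk⇔ (to ∘ Equivalence.to (γᴿᵖ≡γᴿ⇔ G H)) (Equivalence.from (γᴿᵖ≡γᴿ⇔ G H) ∘ from)
    where
    Δ+3≤m : Δ H + 3 ≤ m
    Δ+3≤m = ≤-trans (+-monoʳ-≤ (Δ H) (n≤1+n 3)) Δ≤

    c : Fin m
    c = proj₁ (Δ-attained H v₀)

    -- The surcharge that a row of type `center` really has. It is at least 3 here, but is
    -- multiplied by 0 when `B` is empty.
    l : ℕ
    l = m ∸ suc (degree H c)

    degree-c : degree H c + suc l ≡ m
    degree-c = trans (+-suc _ l) (m+[n∸m]≡n (≤-trans (≤-reflexive (+-comm 1 (degree H c)))
      (≤-trans (+-monoʳ-≤ (degree H c) (s≤s z≤n)) (degree-bound Δ≤ c))))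

    label-total-⊥ : ∀ c₀ D → total G H (label G H c c₀ D ⊥) ≡ 2 * ∣ D ∣
    label-total-⊥ c₀ D = trans (label-total G H c c₀ D ⊥ (⊆-min D) degree-c) (cost-⊥ G l D)

    to : (∃ λ F → PRDF G H F × (∀ F′ → RDF G H F′ → total G H F ≤ total G H F′)) →
         δ H ≡ [ 0 ] × EfficientOpenDomination G
    to (F , prdf , least) =
      let (S , B , perfect , _ , lonely , none-lonely) =
            perfect-cover-below {k = 2} {G = G} {H} {F} prdf neighbour 3≤m ≤-refl (degree-bound Δ+3≤m) least-cover
      -- The degree bound holds with 3 in place of `k` = 2, which empties `B`.
      in conclude perfect lonely (none-lonely 3 ≤-refl (degree-bound Δ≤))
      where
      least-cover : ∀ S B → Cover G S B → total G H F ≤ cost 2 S B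
      least-cover S B cover =
        -- A `center` row would exceed the charge of 4 on a vertex of `B`, so the cover is first
        -- traded for a total dominating set.
        let (D , (_ , reach) , D≤) = totalize G neighbour cover
        in ≤-trans (least _ (label-RDF G H c c D ⊥ (⊆-min D) reach))
                   (≤-trans (≤-reflexive (label-total-⊥ c D)) D≤)

      conclude : ∀ {S B} → PerfectCover G S B → (NoIsolated H → S ⊆ B) → (∀ u → u ∉ B) →
                 δ H ≡ [ 0 ] × EfficientOpenDomination G
      conclude {S} perfect@(_ , unique , _) lonely B-empty =
        [ isolated⇒δ≡0 H
        -- Without isolated vertices in `H`, `S` would lie in the empty `B`, yet `u₀` has a
        -- neighbour in `S`.
        , (λ noIso → let (_ , (_ , x∈S) , _) = unique u₀ (B-empty u₀) in contradiction (lonely noIso x∈S) (B-empty _))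
        ]′ isolated-or-none ,
        S , (λ v → let (x , (vx , x∈S) , _) = unique v (B-empty v) in x , x∈S , ∈N⁺ G (G.adj-sym vx)) ,
        perfect⇒openPacking G perfect

    from : δ H ≡ [ 0 ] × EfficientOpenDomination G →
           ∃ λ F → PRDF G H F × (∀ F′ → RDF G H F′ → total G H F ≤ total G H F′)
    from (δ≡0 , D , efficient , packing) = label G H c c₀ D ⊥ ,
      label-PRDF G H c c₀ D ⊥ (⊆-min D)
        (openPacking⇒perfect G packing cover (λ _ _ u∈ → contradiction u∈ ∉⊥)) (inj₂ iso) ,
      λ F′ rdf → subst (_≤ total G H F′) (trans (cost-⊥ G 2 D) (sym (label-total-⊥ c₀ D)))
        (cheapest≤RDF 2 D ⊥ ≤-refl Δ+3≤m cheapest F′ rdf)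
      where
      c₀  = proj₁ (δ≡0⇒isolated H δ≡0)
      iso = proj₂ (δ≡0⇒isolated H δ≡0)

      cover : Cover G D ⊥
      cover = ⊆-min D , λ u _ → let (x , x∈D , u∈N) = efficient u in x , G.adj-sym (∈N⁻ G u∈N) , x∈D

      cheapest : Cheapest G 2 D ⊥
      cheapest S′ B′ cover′ =
        let (D′ , coverᴰ , D′≤) = totalize G neighbour cover′
        in ≤-trans (≤-reflexive (cost-⊥ G 2 D))
             -- The open packing `D` is no larger than any total dominating set, in particular the
             -- one traded for the given cover.
             (≤-trans (*-monoʳ-≤ 2 (openPacking≤totalDominating G packing (cover⇒totalDominating G coverᴰ))) D′≤)

theorem4p14 : ∀ {n m : ℕ} (G : Graph n) (H : Graph m) →
    Connected G → 2 ≤ n → 3 ≤ m →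
    (Δ H + 1 ≡ m →
    (γᴿᵖ (G ∘ᴳ H) ≡ γᴿ (G ∘ᴳ H)) ⇔
    (γ H ≡ [ 1 ] × EfficientClosedDomination G))
    × (Δ H + 2 ≡ m →
    (γᴿᵖ (G ∘ᴳ H) ≡ γᴿ (G ∘ᴳ H)) ⇔
    (∃₂ λ A B → ζ-Couple G (A , B) × OpenPacking G (A ∪ B) × ([ 1 ] ≤∞ δ H → A ≡ ⊥)))
    × (Δ H + 3 ≡ m →
    (γᴿᵖ (G ∘ᴳ H) ≡ γᴿ (G ∘ᴳ H)) ⇔
    ((δ H ≡ [ 0 ] × ζ′ G ≡ 2 · γₜ G) ⊎
    ([ 1 ] ≤∞ δ H × γₜ G ≡ 2 · γᵖ G × 2 · γᵖ G ≡ [ 2 * ρ G ])))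
    × (Δ H + 4 ≤ m →
    (γᴿᵖ (G ∘ᴳ H) ≡ γᴿ (G ∘ᴳ H)) ⇔
    (δ H ≡ [ 0 ] × EfficientOpenDomination G))
theorem4p14 G H connected 2≤n 3≤m =
  case-i G H neighbour 3≤m , case-ii G H neighbour 3≤m , case-iii G H neighbour 3≤m ,
  case-iv G H neighbour 3≤m (Fin.fromℕ< (≤-trans (s≤s z≤n) 2≤n))
  where
  neighbour = connected⇒noIsolated G 2≤n connected
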